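{- Let $\delta$ be a fixed real number with $0<\delta<1/2$. Then there exist constants $c>0$ and $N$, depending only on $\delta$, such that for every integer $n\ge N$ for which $d=\delta n$ is an integer, $$M(n,d)\;\ge\; c\,n\,\frac{n!}{V(n,d-1)}.$$ Equivalently, with $d/n=\delta$ fixed, $M(n,d)=\Omega\!\left(\frac{n!}{V(n,d-1)}\,n\right)$ as $n\to\infty$.
   Context: $\mathcal{S}_n$ denotes the symmetric group of permutations of $[n]=\{1,\dots,n\}$. The Hamming distance between $\sigma,\tau\in\mathcal{S}_n$ is $d(\sigma,\tau)=|\{i\in[n]:\sigma(i)\ne\tau(i)\}|$. A permutation code $C\subseteq\mathcal{S}_n$ has minimum distance $d$ if every pair of distinct permutations in $C$ is at Hamming distance at least $d$; $M(n,d)$ is the maximum size of a permutation code in $\mathcal{S}_n$ of minimum distance $d$. For $k\ge0$, $D_k$ denotes the number of derangements (fixed-point-free permutations) of $k$ elements (with $D_0=1$), and $V(n,r)=\sum_{k=0}^{r}\binom{n}{k}D_k$ is the volume of a Hamming sphere of radius $r$ in $\mathcal{S}_n$. -}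

module Defs where

open import Data.Nat using (ℕ; zero; suc; _+_; _*_; _≤_; _<_)
open import Data.Nat.Combinatorics using (_C_)
open import Data.Bool using (Bool; true; false; not; _∧_; _∨_)
open import Data.Fin using (Fin; _≟_)
open import Data.Fin.Permutation using (Permutation′; _⟨$⟩ʳ_)
open import Data.Vec using (Vec; []; _∷_; lookup)
open import Data.List using (List; []; _∷_; [_]; length; filter; filterᵇ; allFin; concatMap; map; foldr)
open import Data.List.Relation.Unary.AllPairs using (AllPairs)
open import Data.Product using (_×_)
open import Relation.Nullary using (¬?)
open import Relation.Nullary.Decidable using (⌊_⌋)

hamming : ∀ {n} → Permutation′ n → Permutation′ n → ℕ
hamming {n} σ τ = length (filter (λ i → ¬? ((σ ⟨$⟩ʳ i) ≟ (τ ⟨$⟩ʳ i))) (allFin n))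

-- A permutation code in S_n of minimum distance d, given as a list of
-- permutations: any two entries (at distinct positions) are distinct
-- permutations and are at Hamming distance at least d.
IsPermCode : (n d : ℕ) → List (Permutation′ n) → Set
IsPermCode n d C = AllPairs (λ σ τ → (0 < hamming σ τ) × (d ≤ hamming σ τ)) C

allᵇ : {A : Set} → (A → Bool) → List A → Bool
allᵇ p = foldr (λ x r → p x ∧ r) true

allVecs : (m k : ℕ) → List (Vec (Fin m) k)
allVecs m zero = [ [] ]
allVecs m (suc k) = concatMap (λ i → map (i ∷_) (allVecs m k)) (allFin m)

-- v (viewed as a map Fin k → Fin k) is a derangement: injective (hence a
-- permutation of the finite set Fin k) and fixed-point free
isDerangement : ∀ {k} → Vec (Fin k) k → Bool
isDerangement {k} v =
  allᵇ (λ i → not ⌊ lookup v i ≟ i ⌋) (allFin k) ∧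
  allᵇ (λ i → allᵇ (λ j → ⌊ i ≟ j ⌋ ∨ not ⌊ lookup v i ≟ lookup v j ⌋) (allFin k)) (allFin k)

D : ℕ → ℕ
D k = length (filterᵇ isDerangement (allVecs k k))

V : ℕ → ℕ → ℕ
V n zero = 1
V n (suc r) = V n r + (n C suc r) * D (suc r)

-- Join two permutations of [n] when they agree in at least m = n - d + 1 positions; a code is an independent
-- set of this graph, whose degrees are at most Δ = C(n, m) r! with r = d - 1.  A triangle through σ is given by
-- m - j positions where all three permutations agree and j further ones for each pair; the number of triangles
-- is subexponential times C(n, m) r!², hence smaller than Δ² by a factor exponential in n, as C(n, r) ≥ 2 ^ r.
-- In such a locally sparse graph on N vertices a random independent set I of the hard-core model with fugacity
-- 1 / L, where L² bounds the triangles at a vertex, has size of order N log (Δ / L) / Δ (Shearer's argument):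
-- conditionally on I outside the closed neighbourhood of v, either few neighbours of v are free, and then v ∈ I
-- is likely, or many are, and they span so few edges that I contains many of them.  The factor log (Δ / L) is
-- linear in n, and Δ ≤ 3 V(n, r) because D_r ≥ r! / 3.

module Submission where

open import Defs
open import Data.Nat
open import Data.Nat.Properties
open import Data.Nat.DivMod using (m≡m%n+[m/n]*n; m%n<n; m/n*n≤m; m/n*n≡m; m≥n⇒m/n>0)
open import Data.Nat.Combinatorics using (_C_; nCn≡1; nCk≡nC[n∸k]; nCk+nC[k+1]≡[n+1]C[k+1]; nCk≡n!/k![n-k]!; k![n∸k]!∣n!; k>n⇒nCk≡0)
open import Data.Nat.Tactic.RingSolver using (solve-∀)
open import Data.Bool using (Bool; T; not; _∨_; if_then_else_)
open import Data.Bool.Properties using (T-∧; T?)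
open import Data.Empty using (⊥)
open import Data.Fin as Fin using (Fin; zero; suc; punchIn; punchOut)
open import Data.Fin.Permutation using (Permutation′; permutation)
open import Data.Fin.Properties as Fin using (injective⇒≤; punchIn-injective; punchInᵢ≢i; punchIn-punchOut; punchOut-injective)
open import Data.List using (List; []; _∷_; _++_; length; map; filter; filterᵇ; allFin; upTo; deduplicate; cartesianProduct; cartesianProductWith)
open import Data.List.Membership.Propositional using (_∈_; lose)
open import Data.List.Membership.Propositional.Properties using (∈-∃++; ∈-++⁻; ∈-allFin; ∈-cartesianProduct⁻; ∈-cartesianProductWith⁻; ∈-concatMap⁺; ∈-deduplicate⁺; ∈-deduplicate⁻; ∈-filter⁺; ∈-filter⁻; ∈-map⁺; ∈-map⁻; ∈-upTo⁺; ∈-upTo⁻)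
open import Data.List.Properties using (++-assoc; filter-++; filter-accept; filter-all; filter-none; filter-notAll; filter-reject; filter-some; length-++; length-map; length-tabulate; length-upTo; map-∘)
open import Data.List.Relation.Binary.Permutation.Propositional using (_↭_; prep; swap; ↭-refl; ↭-reflexive; ↭-sym; ↭-trans)
open import Data.List.Relation.Binary.Permutation.Propositional.Properties using (++⁺ˡ; All-resp-↭; filter-↭; shift; shifts; ↭-length; ∈-resp-↭)
open import Data.List.Relation.Binary.Sublist.Propositional using (_⊆_; []; _∷ʳ_; _∷_; ⊆-refl)
open import Data.List.Relation.Binary.Sublist.Propositional.Properties using (All-resp-⊆)
open import Data.List.Relation.Unary.All as All using (All; []; _∷_)
import Data.List.Relation.Unary.All.Properties as All
open import Data.List.Relation.Unary.AllPairs as AllPairs using (AllPairs; []; _∷_; allPairs?)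
import Data.List.Relation.Unary.AllPairs.Properties as AllPairs
open import Data.List.Relation.Unary.Any as Any using (Any; here; there)
import Data.List.Relation.Unary.Any.Properties as Any
open import Data.List.Relation.Unary.Unique.Propositional using (Unique)
import Data.List.Relation.Unary.Unique.DecPropositional.Properties as UniqueDec
import Data.List.Relation.Unary.Unique.Propositional.Properties as Unique
open import Data.Product using (Σ; ∃; _×_; _,_; proj₁; proj₂)
open import Data.Sum using (_⊎_; inj₁; inj₂; [_,_]′)
open import Data.Unit using (tt)
open import Data.Vec as Vec using (Vec; []; _∷_; lookup; tabulate; insertAt; _[_]≔_)
open import Data.Vec.Properties using (insertAt-lookup; insertAt-punchIn; lookup-map; lookup∘update; lookup∘update′; tabulate-cong; tabulate∘lookup; ≡-dec)
open import Function using (_∘_; id)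
open import Function.Bundles using (Equivalence)
open import Level using (0ℓ)
open import Relation.Binary using (DecidableEquality)
open import Relation.Binary.PropositionalEquality using (_≡_; _≢_; refl; sym; trans; cong; cong₂; subst; subst₂; module ≡-Reasoning)
open import Relation.Nullary using (¬_; Dec; yes; no; ¬?; contradiction; does)
open import Relation.Nullary.Decidable using (_×-dec_; ⌊_⌋)
open import Relation.Unary using (Pred; Decidable)
open import Relation.Unary.Properties using (∁?)

-- An integer d = δ n with n > 0 forces δ = p / q, so everything stays in ℕ. Weights of the random
-- set are scaled to integers, expectations become inequalities between weighted sums, and e^x is
-- replaced by powers of 4. The logarithm becomes t = d / 256 rounded down, tied to L by t (1 + L
-- 4^(1 + 8t)) ≤ Δ. Taking L to be the quotient of Δ by W = 2 t 4^(1 + 8t) meets this and avoids a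
-- square root; what remains is that 4 W² times the triangle bound is at most Δ². Triangles are few
-- because a triangle with parameter j, compared with C(n, m) r!², costs only C(m, j) C(r, j) / j!:
-- the third permutation keeps (r - j)! completions instead of r!. For every Y this excess is at
-- most (Y²)^(Y²) (1 + 1/Y)^n, uniformly in j. With Y = 16 q the requirement becomes about 2^(68 t)
-- ≤ 2^r, where r + 1 ≥ 256 t.

private variable
  A B I : Set

-- Finite sums over lists

∑ : List A → (A → ℕ) → ℕ
∑ [] f = 0
∑ (x ∷ xs) f = f x + ∑ xs f

∑-mono : ∀ (xs : List A) {f g : A → ℕ} → All (λ x → f x ≤ g x) xs → ∑ xs f ≤ ∑ xs g
∑-mono [] [] = z≤n
∑-mono (x ∷ xs) (p ∷ ps) = +-mono-≤ p (∑-mono xs ps)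

∑-+ : ∀ (xs : List A) (f g : A → ℕ) → ∑ xs (λ x → f x + g x) ≡ ∑ xs f + ∑ xs g
∑-+ [] f g = refl
∑-+ (x ∷ xs) f g rewrite ∑-+ xs f g = lem (f x) (g x) (∑ xs f) (∑ xs g)
  where
  lem : ∀ a b c d → a + b + (c + d) ≡ a + c + (b + d)
  lem = solve-∀

∑-* : ∀ c (xs : List A) (f : A → ℕ) → ∑ xs (λ x → c * f x) ≡ c * ∑ xs f
∑-* c [] f = sym (*-zeroʳ c)
∑-* c (x ∷ xs) f rewrite ∑-* c xs f = sym (*-distribˡ-+ c (f x) (∑ xs f))

∑-const : ∀ c (xs : List A) → ∑ xs (λ _ → c) ≡ length xs * c
∑-const c [] = refl
∑-const c (x ∷ xs) = cong (c +_) (∑-const c xs)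

∑-map : ∀ (h : A → B) xs (f : B → ℕ) → ∑ (map h xs) f ≡ ∑ xs (f ∘ h)
∑-map h [] f = refl
∑-map h (x ∷ xs) f = cong (f (h x) +_) (∑-map h xs f)

picks : List A → List (A × List A)
picks [] = []
picks (x ∷ xs) = (x , xs) ∷ map (λ (y , r) → y , x ∷ r) (picks xs)

picks-proj₁ : ∀ (xs : List A) → map proj₁ (picks xs) ≡ xs
picks-proj₁ [] = refl
picks-proj₁ (x ∷ xs) = cong (x ∷_) (trans (sym (map-∘ (picks xs))) (picks-proj₁ xs))

∑-picks : ∀ (xs : List A) (f : A → ℕ) → ∑ (picks xs) (f ∘ proj₁) ≡ ∑ xs f
∑-picks xs f = trans (sym (∑-map proj₁ (picks xs) f)) (cong (λ l → ∑ l f) (picks-proj₁ xs))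

picks-↭ : ∀ (xs : List A) → All (λ (x , r) → xs ↭ x ∷ r) (picks xs)
picks-↭ [] = []
picks-↭ (x ∷ xs) = ↭-refl ∷ go (picks-↭ xs)
  where
  go : ∀ {ps} → All (λ (y , r) → xs ↭ y ∷ r) ps →
       All (λ (y , r) → x ∷ xs ↭ y ∷ r) (map (λ (y , r) → y , x ∷ r) ps)
  go [] = []
  go {(y , r) ∷ _} (p ∷ ps) = ↭-trans (prep x p) (swap x y ↭-refl) ∷ go ps

-- Weighted sums over sublists

module WeightedSum (L : ℕ) where

  -- The sum of F over all sublists s of xs, where s has weight L ^ (length xs ∸ length s):
  -- L ^ length xs times the hard-core measure of fugacity 1 / L.
  S : List A → (List A → ℕ) → ℕ
  S [] F = F []
  S (x ∷ xs) F = L * S xs F + S xs (F ∘ (x ∷_))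

  S-mono : ∀ (xs : List A) {F G} → (∀ {s} → s ⊆ xs → F s ≤ G s) → S xs F ≤ S xs G
  S-mono [] h = h []
  S-mono (x ∷ xs) h =
    +-mono-≤ (*-monoʳ-≤ L (S-mono xs (h ∘ (x ∷ʳ_)))) (S-mono xs (h ∘ (refl ∷_)))

  S-cong : ∀ (xs : List A) {F G} → (∀ {s} → s ⊆ xs → F s ≡ G s) → S xs F ≡ S xs G
  S-cong xs h = ≤-antisym (S-mono xs (≤-reflexive ∘ h)) (S-mono xs (≤-reflexive ∘ sym ∘ h))

  S-* : ∀ c (xs : List A) F → S xs (λ s → c * F s) ≡ c * S xs F
  S-* c [] F = refl
  S-* c (x ∷ xs) F rewrite S-* c xs F | S-* c xs (F ∘ (x ∷_)) =
    lem c L (S xs F) (S xs (F ∘ (x ∷_)))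
    where
    lem : ∀ c l a b → l * (c * a) + c * b ≡ c * (l * a + b)
    lem = solve-∀

  S-+ : ∀ (xs : List A) F G → S xs (λ s → F s + G s) ≡ S xs F + S xs G
  S-+ [] F G = refl
  S-+ (x ∷ xs) F G rewrite S-+ xs F G | S-+ xs (F ∘ (x ∷_)) (G ∘ (x ∷_)) =
    lem L (S xs F) (S xs G) (S xs (F ∘ (x ∷_))) (S xs (G ∘ (x ∷_)))
    where
    lem : ∀ l a b c d → l * (a + b) + (c + d) ≡ l * a + c + (l * b + d)
    lem = solve-∀

  S-0 : ∀ (xs : List A) → S xs (λ _ → 0) ≡ 0
  S-0 xs = S-* 0 xs (λ _ → 0)

  S-∑ : ∀ (xs : List A) (vs : List B) (F : B → List A → ℕ) →
        S xs (λ s → ∑ vs (λ v → F v s)) ≡ ∑ vs (λ v → S xs (F v))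
  S-∑ xs [] F = S-0 xs
  S-∑ xs (v ∷ vs) F = trans (S-+ xs (F v) _) (cong (S xs (F v) +_) (S-∑ xs vs F))

  S-++ : ∀ (xs ys : List A) F → S (xs ++ ys) F ≡ S xs (λ t → S ys (λ s → F (t ++ s)))
  S-++ [] ys F = refl
  S-++ (x ∷ xs) ys F = cong₂ (λ a b → L * a + b) (S-++ xs ys F) (S-++ xs ys (F ∘ (x ∷_)))

  ↭-Invariant : (List A → ℕ) → Set
  ↭-Invariant F = ∀ {s s′} → s ↭ s′ → F s ≡ F s′

  S-resp-↭ : ∀ {xs ys : List A} {F} → ↭-Invariant F → xs ↭ ys → S xs F ≡ S ys F
  S-resp-↭ inv _↭_.refl = refl
  S-resp-↭ inv (prep x p) =
    cong₂ (λ a b → L * a + b) (S-resp-↭ inv p) (S-resp-↭ (inv ∘ prep x) p)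
  S-resp-↭ {xs = _ ∷ _ ∷ xs} {_ ∷ _ ∷ ys} {F} inv (swap x y p)
    rewrite S-resp-↭ inv p | S-resp-↭ (inv ∘ prep x) p | S-resp-↭ (inv ∘ prep y) p
          | S-resp-↭ (inv ∘ prep x ∘ prep y) p =
    trans (lem L (S ys F) (S ys (F ∘ (x ∷_))) (S ys (F ∘ (y ∷_))) (S ys (F ∘ (x ∷_) ∘ (y ∷_))))
          (cong (λ d → L * (L * S ys F + S ys (F ∘ (x ∷_))) + (L * S ys (F ∘ (y ∷_)) + d))
                (S-cong ys (λ _ → inv (swap x y ↭-refl))))
    where
    lem : ∀ l a b c d → l * (l * a + c) + (l * b + d) ≡ l * (l * a + b) + (l * c + d)
    lem = solve-∀
  S-resp-↭ inv (_↭_.trans p q) = trans (S-resp-↭ inv p) (S-resp-↭ inv q)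

  -- Sublists meeting `P` contribute nothing, so each entry in `P` is absent and leaves only its
  -- factor `L`.
  S-filter : ∀ {P : Pred A 0ℓ} (P? : Decidable P) xs F → (∀ {s} → Any P s → F s ≡ 0) →
             S xs F ≡ L ^ length (filter P? xs) * S (filter (∁? P?) xs) F
  S-filter P? [] F h = sym (+-identityʳ _)
  S-filter P? (x ∷ xs) F h with P? x
  ... | yes p rewrite S-filter P? xs F h
                    | trans (S-cong xs {F ∘ (x ∷_)} {λ _ → 0} (λ _ → h (here p))) (S-0 xs) =
    trans (+-identityʳ _) (sym (*-assoc L _ _))
  ... | no _ rewrite S-filter P? xs F h | S-filter P? xs (F ∘ (x ∷_)) (h ∘ there) =
    lem L (L ^ length (filter P? xs)) _ _
    where
    lem : ∀ l k a b → l * (k * a) + k * b ≡ k * (l * a + b)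
    lem = solve-∀

  Hereditary : (List A → ℕ) → Set
  Hereditary F = ∀ {s s′} → s ⊆ s′ → F s′ ≤ F s

  -- Deleting the entries in `P` from a sublist cannot decrease `F`; the two states of such an
  -- entry, absent and present, have weights `L` and 1.
  S-hereditary : ∀ {P : Pred A 0ℓ} (P? : Decidable P) xs F → Hereditary F →
                 S xs F ≤ (1 + L) ^ length (filter P? xs) * S (filter (∁? P?) xs) F
  S-hereditary P? [] F h = ≤-reflexive (sym (+-identityʳ _))
  S-hereditary P? (x ∷ xs) F h with P? x
  ... | yes p = begin
    L * S xs F + S xs (F ∘ (x ∷_)) ≤⟨ +-monoʳ-≤ (L * S xs F) (S-mono xs (λ _ → h (x ∷ʳ ⊆-refl))) ⟩
    L * S xs F + S xs F            ≡⟨ +-comm (L * S xs F) _ ⟩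
    (1 + L) * S xs F               ≤⟨ *-monoʳ-≤ (1 + L) (S-hereditary P? xs F h) ⟩
    (1 + L) * (k * S ys F)         ≡⟨ sym (*-assoc (1 + L) k _) ⟩
    (1 + L) * k * S ys F ∎
    where
    open ≤-Reasoning
    k = (1 + L) ^ length (filter P? xs)
    ys = filter (∁? P?) xs
  ... | no _ = begin
    L * S xs F + S xs (F ∘ (x ∷_))
      ≤⟨ +-mono-≤ (*-monoʳ-≤ L (S-hereditary P? xs F h)) (S-hereditary P? xs (F ∘ (x ∷_)) (h ∘ (refl ∷_))) ⟩
    L * (k * S ys F) + k * S ys (F ∘ (x ∷_))
      ≡⟨ lem L k (S ys F) (S ys (F ∘ (x ∷_))) ⟩
    k * (L * S ys F + S ys (F ∘ (x ∷_))) ∎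
    where
    open ≤-Reasoning
    k = (1 + L) ^ length (filter P? xs)
    ys = filter (∁? P?) xs
    lem : ∀ l k a b → l * (k * a) + k * b ≡ k * (l * a + b)
    lem = solve-∀

  S-lower : ∀ (xs : List A) F → L ^ length xs * F [] ≤ S xs F
  S-lower [] F = ≤-reflexive (+-identityʳ _)
  S-lower (x ∷ xs) F = begin
    L * L ^ length xs * F [] ≡⟨ *-assoc L _ _ ⟩
    L * (L ^ length xs * F []) ≤⟨ *-monoʳ-≤ L (S-lower xs F) ⟩
    L * S xs F ≤⟨ m≤m+n _ _ ⟩
    L * S xs F + S xs (F ∘ (x ∷_)) ∎
    where open ≤-Reasoning

  S-upper : ∀ (xs : List A) → S xs (λ _ → 1) ≡ (1 + L) ^ length xs
  S-upper [] = refl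
  S-upper (x ∷ xs) rewrite S-upper xs = +-comm (L * (1 + L) ^ length xs) _

  -- The first moment method: the weights are nonnegative, so a strict inequality between sums is
  -- strict at some sublist.
  S-witness : ∀ (xs : List A) {F G} → S xs F < S xs G → ∃ λ s → s ⊆ xs × F s < G s
  S-witness [] lt = [] , [] , lt
  S-witness (x ∷ xs) {F} {G} lt with S xs F <? S xs G
  ... | yes lt₁ with s , s⊆ , p ← S-witness xs lt₁ = s , x ∷ʳ s⊆ , p
  ... | no ge with s , s⊆ , p ← S-witness xs {F ∘ (x ∷_)} {G ∘ (x ∷_)}
                     (+-cancelˡ-< (L * S xs G) _ _
                       (≤-<-trans (+-monoˡ-≤ _ (*-monoʳ-≤ L (≮⇒≥ ge))) lt)) =
    x ∷ s , refl ∷ s⊆ , p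

  -- Double counting of the pairs of a sublist and one of its entries. The distinguished entry is
  -- present, with weight 1, and invariance lets it stand in front.
  S-picks : ∀ (xs : List A) F → ↭-Invariant F →
            S xs (λ s → length s * F s) ≡ ∑ (picks xs) (λ (x , r) → S r (F ∘ (x ∷_)))
  S-picks [] F inv = refl
  S-picks (x ∷ xs) F inv = begin
    L * S xs (λ s → length s * F s) + S xs (λ s → F (x ∷ s) + length s * F (x ∷ s))
      ≡⟨ cong₂ (λ a b → L * a + b) (S-picks xs F inv)
           (trans (S-+ xs (F ∘ (x ∷_)) _)
             (cong (S xs (F ∘ (x ∷_)) +_) (S-picks xs (F ∘ (x ∷_)) (inv ∘ prep x)))) ⟩
    L * ∑ ps f + (S xs (F ∘ (x ∷_)) + ∑ ps g)
      ≡⟨ lem (L * ∑ ps f) (S xs (F ∘ (x ∷_))) (∑ ps g) ⟩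
    S xs (F ∘ (x ∷_)) + (L * ∑ ps f + ∑ ps g)
      ≡⟨ cong (λ a → S xs (F ∘ (x ∷_)) + (a + ∑ ps g)) (sym (∑-* L ps f)) ⟩
    S xs (F ∘ (x ∷_)) + (∑ ps (λ p → L * f p) + ∑ ps g)
      ≡⟨ cong (S xs (F ∘ (x ∷_)) +_) (sym (∑-+ ps (λ p → L * f p) g)) ⟩
    S xs (F ∘ (x ∷_)) + ∑ ps (λ p → L * f p + g p)
      ≡⟨ cong (S xs (F ∘ (x ∷_)) +_) (∑-cong ps (λ (y , r) → cong (L * S r (F ∘ (y ∷_)) +_)
           (S-cong r (λ _ → inv (swap x y ↭-refl))))) ⟩
    S xs (F ∘ (x ∷_)) + ∑ ps (λ (y , r) → S (x ∷ r) (F ∘ (y ∷_)))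
      ≡⟨ cong (S xs (F ∘ (x ∷_)) +_) (sym (∑-map _ ps _)) ⟩
    S xs (F ∘ (x ∷_)) + ∑ (map (λ (y , r) → y , x ∷ r) ps) (λ (y , r) → S r (F ∘ (y ∷_))) ∎
    where
    open ≡-Reasoning
    ps = picks xs
    f g : _ → ℕ
    f (y , r) = S r (F ∘ (y ∷_))
    g (y , r) = S r (F ∘ (x ∷_) ∘ (y ∷_))
    lem : ∀ a b c → a + (b + c) ≡ b + (a + c)
    lem = solve-∀
    ∑-cong : ∀ (zs : List (_ × List _)) {f g : _ → ℕ} → (∀ z → f z ≡ g z) → ∑ zs f ≡ ∑ zs g
    ∑-cong [] h = refl
    ∑-cong (z ∷ zs) h = cong₂ _+_ (h z) (∑-cong zs h)

-- Bernoulli's inequality and integer substitutes for (1 + 1/L)^m ≤ e^(m/L)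

bernoulli : ∀ L k → (1 + L) ^ k * (1 + L) ≤ L ^ k * (1 + L) + k * (1 + L) ^ k
bernoulli L zero = ≤-reflexive (sym (+-identityʳ _))
bernoulli L (suc k) = begin
  (1 + L) * K * (1 + L)                       ≡⟨ *-assoc (1 + L) K (1 + L) ⟩
  (1 + L) * (K * (1 + L))                     ≤⟨ *-monoʳ-≤ (1 + L) (bernoulli L k) ⟩
  (1 + L) * (l * (1 + L) + k * K)             ≡⟨ lem₁ L l k K ⟩
  L * l * (1 + L) + (1 + L) * l + k * ((1 + L) * K)
    ≤⟨ +-monoˡ-≤ _ (+-monoʳ-≤ (L * l * (1 + L)) (*-monoʳ-≤ (1 + L) (^-monoˡ-≤ k (n≤1+n L)))) ⟩
  L * l * (1 + L) + (1 + L) * K + k * ((1 + L) * K) ≡⟨ +-assoc (L * l * (1 + L)) _ _ ⟩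
  L * l * (1 + L) + suc k * ((1 + L) * K) ∎
  where
  open ≤-Reasoning
  K = (1 + L) ^ k
  l = L ^ k
  lem₁ : ∀ L l k K → (1 + L) * (l * (1 + L) + k * K) ≡ L * l * (1 + L) + (1 + L) * l + k * ((1 + L) * K)
  lem₁ = solve-∀

[1+L]^k≤2*L^k : ∀ L k → k + k ≤ 1 + L → (1 + L) ^ k ≤ 2 * L ^ k
[1+L]^k≤2*L^k L k h = *-cancelʳ-≤ K (2 * l) (1 + L) (+-cancelʳ-≤ (K * (1 + L)) _ _ (begin
  K * (1 + L) + K * (1 + L)                     ≤⟨ +-mono-≤ (bernoulli L k) (bernoulli L k) ⟩
  l * (1 + L) + k * K + (l * (1 + L) + k * K)   ≡⟨ lem L l k K ⟩
  2 * l * (1 + L) + K * (k + k)                 ≤⟨ +-monoʳ-≤ (2 * l * (1 + L)) (*-monoʳ-≤ K h) ⟩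
  2 * l * (1 + L) + K * (1 + L) ∎))
  where
  open ≤-Reasoning
  K = (1 + L) ^ k
  l = L ^ k
  lem : ∀ L l k K → l * (1 + L) + k * K + (l * (1 + L) + k * K) ≡ 2 * l * (1 + L) + K * (k + k)
  lem = solve-∀

-- Twice either half of `m` is at most 1 + `L`, so each half costs a factor 2; the 4 stands for e.
[1+L]^m≤4*L^m : ∀ L m → m ≤ L → (1 + L) ^ m ≤ 4 * L ^ m
[1+L]^m≤4*L^m L m m≤L = begin
  (1 + L) ^ m               ≡⟨ cong ((1 + L) ^_) (sym k+k′≡m) ⟩
  (1 + L) ^ (k + k′)        ≡⟨ ^-distribˡ-+-* (1 + L) k k′ ⟩
  (1 + L) ^ k * (1 + L) ^ k′
    ≤⟨ *-mono-≤ ([1+L]^k≤2*L^k L k (≤-trans (twice m) (≤-trans m≤L (n≤1+n L))))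
                ([1+L]^k≤2*L^k L k′ (≤-trans (twice (suc m)) (s≤s m≤L))) ⟩
  2 * L ^ k * (2 * L ^ k′)  ≡⟨ lem (L ^ k) (L ^ k′) ⟩
  4 * (L ^ k * L ^ k′)      ≡⟨ cong (4 *_) (sym (^-distribˡ-+-* L k k′)) ⟩
  4 * L ^ (k + k′)          ≡⟨ cong (λ j → 4 * L ^ j) k+k′≡m ⟩
  4 * L ^ m ∎
  where
  open ≤-Reasoning
  k = ⌊ m /2⌋
  k′ = ⌈ m /2⌉
  k+k′≡m = ⌊n/2⌋+⌈n/2⌉≡n m
  twice : ∀ n → ⌊ n /2⌋ + ⌊ n /2⌋ ≤ n
  twice n = ≤-trans (+-monoʳ-≤ ⌊ n /2⌋ (⌊n/2⌋≤⌈n/2⌉ n)) (≤-reflexive (⌊n/2⌋+⌈n/2⌉≡n n))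
  lem : ∀ a b → 2 * a * (2 * b) ≡ 4 * (a * b)
  lem = solve-∀

-- The exponent is cut into at most `s` blocks of length at most `L`, each costing a factor 4.
[1+L]^m≤4^s*L^m : ∀ L s m → m ≤ s * L → (1 + L) ^ m ≤ 4 ^ s * L ^ m
[1+L]^m≤4^s*L^m L zero m h rewrite n≤0⇒n≡0 h = ≤-refl
[1+L]^m≤4^s*L^m L (suc s) m h with ≤-total m L
... | inj₁ m≤L = ≤-trans ([1+L]^m≤4*L^m L m m≤L) (*-monoˡ-≤ (L ^ m) (begin
  4         ≡⟨⟩
  4 * 1     ≤⟨ *-monoʳ-≤ 4 (m^n>0 4 s) ⟩
  4 * 4 ^ s ∎))
  where open ≤-Reasoning
... | inj₂ L≤m = begin
  (1 + L) ^ m                        ≡⟨ cong ((1 + L) ^_) (sym L+m′≡m) ⟩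
  (1 + L) ^ (L + m′)                 ≡⟨ ^-distribˡ-+-* (1 + L) L m′ ⟩
  (1 + L) ^ L * (1 + L) ^ m′
    ≤⟨ *-mono-≤ ([1+L]^m≤4*L^m L L ≤-refl)
         ([1+L]^m≤4^s*L^m L s m′ (+-cancelˡ-≤ L m′ (s * L) (≤-trans (≤-reflexive L+m′≡m) h))) ⟩
  4 * L ^ L * (4 ^ s * L ^ m′)       ≡⟨ lem (4 ^ s) (L ^ L) (L ^ m′) ⟩
  4 * 4 ^ s * (L ^ L * L ^ m′)       ≡⟨ cong (4 * 4 ^ s *_) (sym (^-distribˡ-+-* L L m′)) ⟩
  4 * 4 ^ s * L ^ (L + m′)           ≡⟨ cong (λ j → 4 * 4 ^ s * L ^ j) L+m′≡m ⟩
  4 * 4 ^ s * L ^ m ∎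
  where
  open ≤-Reasoning
  m′ = m ∸ L
  L+m′≡m = m+[n∸m]≡n L≤m
  lem : ∀ a b c → 4 * b * (a * c) ≡ 4 * a * (b * c)
  lem = solve-∀

-- Indicators, pairwise relations and counting in lists

χ : ∀ {P : Set} → Dec P → ℕ
χ d = if does d then 1 else 0

χ-yes : ∀ {P : Set} (d : Dec P) → P → χ d ≡ 1
χ-yes (yes _) p = refl
χ-yes (no ¬p) p = contradiction p ¬p

χ-no : ∀ {P : Set} (d : Dec P) → ¬ P → χ d ≡ 0
χ-no (yes p) ¬p = contradiction p ¬p
χ-no (no _) ¬p = refl

χ≤1 : ∀ {P : Set} (d : Dec P) → χ d ≤ 1
χ≤1 (yes _) = ≤-refl
χ≤1 (no _) = z≤n

χ-mono : ∀ {P Q : Set} (d : Dec P) (e : Dec Q) → (P → Q) → χ d ≤ χ e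
χ-mono (yes p) e f rewrite χ-yes e (f p) = ≤-refl
χ-mono (no _) e f = z≤n

AllPairs-resp-⊆ : ∀ {R : A → A → Set} {xs ys} → xs ⊆ ys → AllPairs R ys → AllPairs R xs
AllPairs-resp-⊆ [] [] = []
AllPairs-resp-⊆ (y ∷ʳ p) (_ ∷ r) = AllPairs-resp-⊆ p r
AllPairs-resp-⊆ (refl ∷ p) (h ∷ r) = All-resp-⊆ p h ∷ AllPairs-resp-⊆ p r

AllPairs-resp-↭ : ∀ {R : A → A → Set} → (∀ {x y} → R x y → R y x) →
                  ∀ {xs ys} → xs ↭ ys → AllPairs R xs → AllPairs R ys
AllPairs-resp-↭ sy _↭_.refl h = h
AllPairs-resp-↭ sy (prep x p) (h ∷ r) = All-resp-↭ p h ∷ AllPairs-resp-↭ sy p r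
AllPairs-resp-↭ sy (swap x y p) ((h ∷ hx) ∷ hy ∷ r) =
  (sy h ∷ All-resp-↭ p hy) ∷ All-resp-↭ p hx ∷ AllPairs-resp-↭ sy p r
AllPairs-resp-↭ sy (_↭_.trans p q) h = AllPairs-resp-↭ sy q (AllPairs-resp-↭ sy p h)

AllPairs-++⁻ʳ : ∀ {R : A → A → Set} xs {ys} → AllPairs R (xs ++ ys) → AllPairs R ys
AllPairs-++⁻ʳ [] h = h
AllPairs-++⁻ʳ (x ∷ xs) (_ ∷ h) = AllPairs-++⁻ʳ xs h

AllPairs-++⁻ˡ : ∀ {R : A → A → Set} xs {ys} → AllPairs R (xs ++ ys) → AllPairs R xs
AllPairs-++⁻ˡ [] h = []
AllPairs-++⁻ˡ (x ∷ xs) (p ∷ h) = All.++⁻ˡ xs p ∷ AllPairs-++⁻ˡ xs h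

filter-split-↭ : ∀ {P : Pred A 0ℓ} (P? : Decidable P) xs → xs ↭ filter (∁? P?) xs ++ filter P? xs
filter-split-↭ P? [] = ↭-refl
filter-split-↭ P? (x ∷ xs) with P? x
... | yes _ = ↭-trans (prep x (filter-split-↭ P? xs)) (↭-sym (shift x (filter (∁? P?) xs) (filter P? xs)))
... | no _ = prep x (filter-split-↭ P? xs)

∑-length-filter : ∀ {R : A → B → Set} (R? : ∀ x y → Dec (R x y)) xs ys →
                  ∑ xs (λ x → length (filter (R? x) ys)) ≡ ∑ ys (λ y → length (filter (λ x → R? x y) xs))
∑-length-filter R? xs [] = trans (∑-const 0 xs) (*-zeroʳ (length xs))
∑-length-filter R? xs (y ∷ ys) = trans (step xs) (cong (length (filter (λ x → R? x y) xs) +_) (∑-length-filter R? xs ys))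
  where
  open ≡-Reasoning
  f = λ x → length (filter (R? x) ys)
  lem : ∀ a b c → a + (b + c) ≡ b + (a + c)
  lem = solve-∀
  step : ∀ xs → ∑ xs (λ x → length (filter (R? x) (y ∷ ys)))
         ≡ length (filter (λ x → R? x y) xs) + ∑ xs (λ x → length (filter (R? x) ys))
  step [] = refl
  step (x ∷ xs) with R? x y
  ... | yes _ = cong suc (trans (cong (f x +_) (step xs)) (lem (f x) (length (filter (λ x → R? x y) xs)) (∑ xs f)))
  ... | no _ = trans (cong (f x +_) (step xs)) (lem (f x) (length (filter (λ x → R? x y) xs)) (∑ xs f))

Unique⇒count≤1 : (_≟_ : DecidableEquality A) → ∀ {xs} → Unique xs → ∀ u → length (filter (u ≟_) xs) ≤ 1
Unique⇒count≤1 _≟_ [] u = z≤n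
Unique⇒count≤1 _≟_ {x ∷ xs} (h ∷ uq) u with u ≟ x
... | yes refl rewrite filter-none (u ≟_) h = ≤-refl
... | no _ = Unique⇒count≤1 _≟_ uq u

-- Independent sets in graphs with sparse neighbourhoods

module HardCore {A : Set} (_≟_ : DecidableEquality A)
                {Adj : A → A → Set} (adj? : ∀ x y → Dec (Adj x y))
                (Adj-sym : ∀ {x y} → Adj x y → Adj y x) where

  -- Only entries at different positions are compared, so loops do no harm; in the application each
  -- permutation is adjacent to itself.
  Indep : List A → Set
  Indep = AllPairs (λ x y → ¬ Adj x y)

  indep? : ∀ s → Dec (Indep s)
  indep? = allPairs? (λ x y → ¬? (adj? x y))

  ind : List A → ℕ
  ind s = χ (indep? s)

  Indep-resp-↭ : ∀ {s s′} → s ↭ s′ → Indep s → Indep s′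
  Indep-resp-↭ = AllPairs-resp-↭ (λ na → na ∘ Adj-sym)

  ind-↭ : ∀ {s s′} → s ↭ s′ → ind s ≡ ind s′
  ind-↭ {s} {s′} p = ≤-antisym
    (χ-mono (indep? s) (indep? s′) (Indep-resp-↭ p))
    (χ-mono (indep? s′) (indep? s) (Indep-resp-↭ (↭-sym p)))

  degree : A → List A → ℕ
  degree x s = length (filter (adj? x) s)

  module Local (L : ℕ) .{{_ : NonZero L}} where
    open WeightedSum L

    ind-hereditary : Hereditary ind
    ind-hereditary {s} {s′} p = χ-mono (indep? s′) (indep? s) (AllPairs-resp-⊆ p)

    -- The partition function of the hard-core model on `F` and the unnormalised mean size: M F / Z
    -- F is the expected size of the random independent set.
    Z M : List A → ℕ
    Z F = S F ind
    M F = S F (λ s → length s * ind s)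

    L^n≤Z : ∀ F → L ^ length F ≤ Z F
    L^n≤Z F = ≤-trans (≤-reflexive (sym (*-identityʳ _))) (S-lower F ind)

    Z≤[1+L]^n : ∀ F → Z F ≤ (1 + L) ^ length F
    Z≤[1+L]^n F = ≤-trans (S-mono F (λ {s} _ → χ≤1 (indep? s))) (≤-reflexive (S-upper F))

    -- If `x` has fewer than `L` neighbours in `F`, forgetting the states of these and of `x` costs
    -- at most (1 + 1/L)^L ≤ 4, so `x` is occupied with probability at least 1 / (4L). The last term
    -- makes the inequality trivial for the other vertices and is linear in the degree, ready for
    -- summation.
    Z-pick : ∀ {F x r} → F ↭ x ∷ r →
             Z F * L ≤ 4 * L * L * S r (ind ∘ (x ∷_)) + Z F * degree x F
    Z-pick {F} {x} {r} F↭ with L ≤? degree x F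
    ... | yes L≤ = ≤-trans (*-monoʳ-≤ (Z F) L≤) (m≤n+m _ _)
    ... | no L≰ = ≤-trans (begin
      Z F * L                                ≡⟨ cong (_* L) (S-resp-↭ ind-↭ F↭) ⟩
      (L * Z r + S r (ind ∘ (x ∷_))) * L     ≤⟨ *-monoˡ-≤ L (+-monoʳ-≤ (L * Z r)
                                                  (S-mono r (λ {s} _ → ind-hereditary {s} (x ∷ʳ ⊆-refl)))) ⟩
      (L * Z r + Z r) * L                    ≡⟨ cong (_* L) (+-comm (L * Z r) (Z r)) ⟩
      (1 + L) * Z r * L                      ≤⟨ *-monoˡ-≤ L (*-monoʳ-≤ (1 + L) (S-hereditary (adj? x) r ind ind-hereditary)) ⟩
      (1 + L) * ((1 + L) ^ k * Z r′) * L     ≡⟨ cong (_* L) (sym (*-assoc (1 + L) ((1 + L) ^ k) (Z r′))) ⟩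
      (1 + L) ^ suc k * Z r′ * L             ≤⟨ *-monoˡ-≤ L (*-monoˡ-≤ (Z r′) ([1+L]^m≤4*L^m L (suc k) 1+k≤L)) ⟩
      4 * (L * L ^ k) * Z r′ * L             ≡⟨ lem L (L ^ k) (Z r′) ⟩
      4 * L * L * (L ^ k * Z r′)             ≤⟨ *-monoʳ-≤ (4 * L * L) (*-monoʳ-≤ (L ^ k) (S-mono r′ (λ {s} s⊆ → mono s s⊆))) ⟩
      4 * L * L * (L ^ k * S r′ (ind ∘ (x ∷_))) ≡⟨ cong (4 * L * L *_) (sym (S-filter (adj? x) r (ind ∘ (x ∷_)) zeros)) ⟩
      4 * L * L * S r (ind ∘ (x ∷_)) ∎) (m≤m+n _ _)
      where
      open ≤-Reasoning
      k = degree x r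
      r′ = filter (∁? (adj? x)) r
      1+k≤L : suc k ≤ L
      1+k≤L = ≤-trans (s≤s (≤-trans deg-tail (≤-reflexive (sym (↭-length (filter-↭ (adj? x) F↭)))))) (≰⇒> L≰)
        where
        deg-tail : k ≤ degree x (x ∷ r)
        deg-tail with adj? x x
        ... | yes _ = n≤1+n _
        ... | no _ = ≤-refl
      lem : ∀ L a b → 4 * (L * a) * b * L ≡ 4 * L * L * (a * b)
      lem = solve-∀
      mono : ∀ s → s ⊆ r′ → ind s ≤ ind (x ∷ s)
      mono s s⊆ = χ-mono (indep? s) (indep? (x ∷ s)) (All-resp-⊆ s⊆ (All.all-filter (∁? (adj? x)) r) ∷_)
      zeros : ∀ {s} → Any (Adj x) s → ind (x ∷ s) ≡ 0
      zeros {s} a = χ-no (indep? (x ∷ s)) (λ i → All.All¬⇒¬Any (AllPairs.head i) a)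

    -- Summing `Z-pick` over the vertices of `F`, the degrees cost at most `L * L` in total; hence
    -- the expected size is at least (length F - L) / (4L).
    n*Z≤4LM+LZ : ∀ F → ∑ F (λ x → degree x F) ≤ L * L → length F * Z F ≤ 4 * L * M F + L * Z F
    n*Z≤4LM+LZ F edges = *-cancelʳ-≤ _ _ L (begin
      length F * Z F * L                ≡⟨ *-assoc (length F) _ _ ⟩
      length F * (Z F * L)              ≡⟨ sym (∑-const (Z F * L) F) ⟩
      ∑ F (λ _ → Z F * L)               ≡⟨ sym (∑-picks F (λ _ → Z F * L)) ⟩
      ∑ (picks F) (λ _ → Z F * L)       ≤⟨ ∑-mono (picks F) (All.map Z-pick (picks-↭ F)) ⟩
      ∑ (picks F) (λ (x , r) → 4 * L * L * S r (ind ∘ (x ∷_)) + Z F * degree x F)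
        ≡⟨ ∑-+ (picks F) (λ (x , r) → 4 * L * L * S r (ind ∘ (x ∷_))) (λ (x , r) → Z F * degree x F) ⟩
      ∑ (picks F) (λ (x , r) → 4 * L * L * S r (ind ∘ (x ∷_))) + ∑ (picks F) (λ (x , r) → Z F * degree x F)
        ≡⟨ cong₂ _+_ (∑-* (4 * L * L) (picks F) _)
             (trans (∑-picks F (λ x → Z F * degree x F)) (∑-* (Z F) F (λ x → degree x F))) ⟩
      4 * L * L * ∑ (picks F) (λ (x , r) → S r (ind ∘ (x ∷_))) + Z F * ∑ F (λ x → degree x F)
        ≡⟨ cong (λ a → 4 * L * L * a + Z F * ∑ F (λ x → degree x F)) (sym (S-picks F ind ind-↭)) ⟩
      4 * L * L * M F + Z F * ∑ F (λ x → degree x F) ≤⟨ +-monoʳ-≤ (4 * L * L * M F) (*-monoʳ-≤ (Z F) edges) ⟩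
      4 * L * L * M F + Z F * (L * L)   ≡⟨ lem L (M F) (Z F) ⟩
      (4 * L * M F + L * Z F) * L ∎)
      where
      open ≤-Reasoning
      lem : ∀ L m z → 4 * L * L * m + z * (L * L) ≡ (4 * L * m + L * z) * L
      lem = solve-∀

    module Bound (τ Δ : ℕ) (Δ-large : τ * (1 + L * 4 ^ (1 + 8 * τ)) ≤ Δ) where
      -- Here `F` is the set of neighbours of a vertex v left free by the outside. The conditional
      -- weight is `L * Z F` when v is absent and `L ^ length F` when v is present, since then `F`
      -- is empty of chosen vertices. The right side is the weighted sum of Δ [v ∈ I] + |I ∩ F|, so
      -- the claim is that its conditional mean is at least `τ`.
      local-bound : ∀ F → ∑ F (λ x → degree x F) ≤ L * L →
                    τ * (L * Z F + L ^ length F) ≤ L * M F + L ^ length F * Δ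
      local-bound F edges with ≤-total (length F) ((1 + 8 * τ) * L)
      -- Few free neighbours: the total weight is at most 1 + L 4^(1 + 8τ) times the weight of v
      -- present, and `Δ-large` lets the term with `Δ` suffice.
      ... | inj₁ small = ≤-trans (begin
        τ * (L * Z F + K)                              ≤⟨ *-monoʳ-≤ τ (+-monoˡ-≤ K (*-monoʳ-≤ L
                                                            (≤-trans (Z≤[1+L]^n F) ([1+L]^m≤4^s*L^m L (1 + 8 * τ) (length F) small)))) ⟩
        τ * (L * (4 ^ (1 + 8 * τ) * K) + K)            ≡⟨ lem τ L (4 ^ (1 + 8 * τ)) K ⟩
        K * (τ * (1 + L * 4 ^ (1 + 8 * τ)))            ≤⟨ *-monoʳ-≤ K Δ-large ⟩
        K * Δ ∎) (m≤n+m _ _)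
        where
        open ≤-Reasoning
        K = L ^ length F
        lem : ∀ τ L q k → τ * (L * (q * k) + k) ≡ k * (τ * (1 + L * q))
        lem = solve-∀
      -- Many free neighbours: length F - L is at least 8 τ L, so the mean size is at least 2 τ. One
      -- τ pays for `L * Z F`, the other for `L ^ length F`, which is at most `Z F`.
      ... | inj₂ large = ≤-trans (begin
        τ * (L * Z F + L ^ length F)    ≤⟨ *-monoʳ-≤ τ (+-monoʳ-≤ (L * Z F) (≤-trans (L^n≤Z F) (m≤n*m (Z F) L))) ⟩
        τ * (L * Z F + L * Z F)         ≡⟨ lem₁ τ L (Z F) ⟩
        L * (2 * τ * Z F)               ≤⟨ *-monoʳ-≤ L 2tZ≤M ⟩
        L * M F ∎) (m≤m+n _ _)
        where
        open ≤-Reasoning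
        lem₁ : ∀ τ L z → τ * (L * z + L * z) ≡ L * (2 * τ * z)
        lem₁ = solve-∀
        lem₂ : ∀ τ L z → 4 * L * (2 * τ * z) + L * z ≡ (1 + 8 * τ) * L * z
        lem₂ = solve-∀
        2tZ≤M : 2 * τ * Z F ≤ M F
        2tZ≤M = *-cancelˡ-≤ (4 * L) {{m*n≢0 4 L}} (+-cancelʳ-≤ (L * Z F) _ _ (begin
          4 * L * (2 * τ * Z F) + L * Z F ≡⟨ lem₂ τ L (Z F) ⟩
          (1 + 8 * τ) * L * Z F           ≤⟨ *-monoˡ-≤ (Z F) large ⟩
          length F * Z F                  ≤⟨ n*Z≤4LM+LZ F edges ⟩
          4 * L * M F + L * Z F ∎))

      module Averaging (Vs : List A) (Vs-unique : Unique Vs)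
        (degrees : ∀ u → u ∈ Vs → length (filter (λ v → adj? v u) Vs) ≤ Δ)
        (edges : ∀ v → v ∈ Vs → ∀ F → Unique F → All (_∈ Vs) F → All (Adj v) F →
                 ∑ F (λ x → degree x F) ≤ L * L) where

        -- The credit of `v`: `Δ` for its own presence plus its chosen neighbours. The weight `Δ`
        -- balances the two parts, since a chosen vertex is a neighbour of at most `Δ` vertices.
        X : A → List A → ℕ
        X v s = Δ * length (filter (_≟ v) s) + degree v s

        X-↭ : ∀ v {s s′} → s ↭ s′ → X v s ≡ X v s′
        X-↭ v p = cong₂ (λ a b → Δ * a + b) (↭-length (filter-↭ (_≟ v) p)) (↭-length (filter-↭ (adj? v) p))

        module _ {v Ns Rs} (Ns-adj : All (Adj v) Ns) (Rs-nonadj : All (¬_ ∘ Adj v) Rs)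
                 (Ns-unique : Unique Ns) (Ns⊆Vs : All (_∈ Vs) Ns) (v∈Vs : v ∈ Vs) where

          -- The sum over the choices inside the closed neighbourhood of `v`, the choice `t` outside
          -- it being fixed.
          inner : (List A → ℕ) → List A → ℕ
          inner G t = S (v ∷ Ns) (λ s → G (t ++ s))

          ind-++ : ∀ t s → Indep t → All (λ x → ¬ Any (Adj x) t) s → ind (t ++ s) ≡ ind s
          ind-++ t s it na = ≤-antisym
            (χ-mono (indep? (t ++ s)) (indep? s) (AllPairs-++⁻ʳ t))
            (χ-mono (indep? s) (indep? (t ++ s)) (λ is → AllPairs.++⁺ it is (cross t na)))
            where
            cross : ∀ t → All (λ x → ¬ Any (Adj x) t) s → All (λ y → All (λ x → ¬ Adj y x) s) t
            cross [] _ = []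
            cross (y ∷ t) na = All.map (λ h a → h (here (Adj-sym a))) na ∷ cross t (All.map (λ h → h ∘ there) na)

          ind-++-0 : ∀ t {s} → Any (λ x → Any (Adj x) t) s → ind (t ++ s) ≡ 0
          ind-++-0 t {s} a = χ-no (indep? (t ++ s)) (λ i → All.All¬⇒¬Any (cross t i) a)
            where
            cross : ∀ t → Indep (t ++ s) → All (λ x → ¬ Any (Adj x) t) s
            cross [] _ = All.universal (λ _ ()) s
            cross (y ∷ t) (h ∷ i) = All.zipWith (λ { (n , _) (here a) → n (Adj-sym a) ; (_ , n) (there a) → n a })
                                      (All.++⁻ʳ t h , cross t i)

          -- Neighbours of `v` blocked by `t` must be absent and give the common factor `L ^ e`; on
          -- the free ones `t` imposes no further constraint, and `local-bound` applies.
          inner-bound : ∀ {t} → All (¬_ ∘ Adj v) t → τ * inner ind t ≤ inner (λ s → ind s * X v s) t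
          inner-bound {t} tv with indep? t
          ... | no ¬it = ≤-trans (≤-reflexive (trans (cong (τ *_)
                           (trans (S-cong (v ∷ Ns) (λ {s} _ → χ-no (indep? (t ++ s)) (¬it ∘ AllPairs-++⁻ˡ t))) (S-0 (v ∷ Ns))))
                           (*-zeroʳ τ))) z≤n
          ... | yes it = begin
            τ * (L * S Ns (λ s → ind (t ++ s)) + S Ns (λ s → ind (t ++ v ∷ s)))
              ≤⟨ *-monoʳ-≤ τ (+-mono-≤ (≤-reflexive (cong (L *_) without-v)) with-v) ⟩
            τ * (L * (L ^ e * Z F) + L ^ length Ns)          ≡⟨ cong (λ a → τ * (L * (L ^ e * Z F) + a)) split ⟩
            τ * (L * (L ^ e * Z F) + L ^ e * L ^ length F)   ≡⟨ lem₁ τ L (L ^ e) (Z F) (L ^ length F) ⟩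
            L ^ e * (τ * (L * Z F + L ^ length F))           ≤⟨ *-monoʳ-≤ (L ^ e) (local-bound F F-edges) ⟩
            L ^ e * (L * M F + L ^ length F * Δ)             ≡⟨ lem₂ L (L ^ e) (M F) (L ^ length F) Δ ⟩
            L * (L ^ e * M F) + L ^ e * L ^ length F * Δ     ≡⟨ cong (λ a → L * (L ^ e * M F) + a * Δ) (sym split) ⟩
            L * (L ^ e * M F) + L ^ length Ns * Δ            ≤⟨ +-mono-≤ (*-monoʳ-≤ L X-without-v) X-with-v ⟩
            L * S Ns (λ s → ind (t ++ s) * X v (t ++ s)) + S Ns (λ s → ind (t ++ v ∷ s) * X v (t ++ v ∷ s)) ∎
            where
            open ≤-Reasoning
            P? = λ x → Any.any? (adj? x) t
            F = filter (∁? P?) Ns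
            e = length (filter P? Ns)

            F-edges : ∑ F (λ x → degree x F) ≤ L * L
            F-edges = edges v v∈Vs F (AllPairs.filter⁺ (∁? P?) Ns-unique)
                        (All.filter⁺ (∁? P?) Ns⊆Vs) (All.filter⁺ (∁? P?) Ns-adj)

            split : L ^ length Ns ≡ L ^ e * L ^ length F
            split = trans (cong (L ^_) (trans (↭-length (filter-split-↭ P? Ns))
                      (trans (length-++ F) (+-comm (length F) e)))) (^-distribˡ-+-* L e (length F))

            ind-F : ∀ {s} → s ⊆ F → ind (t ++ s) ≡ ind s
            ind-F {s} s⊆ = ind-++ t s it (All-resp-⊆ s⊆ (All.all-filter (∁? P?) Ns))

            without-v : S Ns (λ s → ind (t ++ s)) ≡ L ^ e * Z F
            without-v = trans (S-filter P? Ns (λ s → ind (t ++ s)) (ind-++-0 t))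
                              (cong (L ^ e *_) (S-cong F ind-F))

            -- The presence of `v` excludes all of `Ns`, so only the empty sublist survives.
            with-v : S Ns (λ s → ind (t ++ v ∷ s)) ≤ L ^ length Ns
            with-v = begin
              S Ns f                                                          ≡⟨ S-filter (adj? v) Ns f zeros ⟩
              L ^ length (filter (adj? v) Ns) * S (filter (∁? (adj? v)) Ns) f
                ≡⟨ cong₂ (λ a b → L ^ length a * S b f) (filter-all (adj? v) Ns-adj)
                     (filter-none (∁? (adj? v)) (All.map (λ a n → n a) Ns-adj)) ⟩
              L ^ length Ns * f []                                            ≤⟨ *-monoʳ-≤ (L ^ length Ns) (χ≤1 (indep? (t ++ v ∷ []))) ⟩
              L ^ length Ns * 1                                               ≡⟨ *-identityʳ _ ⟩
              L ^ length Ns ∎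
              where
              f = λ s → ind (t ++ v ∷ s)
              zeros : ∀ {s} → Any (Adj v) s → f s ≡ 0
              zeros {s} a = χ-no (indep? (t ++ v ∷ s)) (λ i → All.All¬⇒¬Any (AllPairs.head (AllPairs-++⁻ʳ t i)) a)

            X-without-v : L ^ e * M F ≤ S Ns (λ s → ind (t ++ s) * X v (t ++ s))
            X-without-v = begin
              L ^ e * M F                                  ≡⟨ cong (L ^ e *_) (S-cong F (λ {s} s⊆ → cong (length s *_) (sym (ind-F s⊆)))) ⟩
              L ^ e * S F (λ s → length s * ind (t ++ s))  ≡⟨ sym (S-filter P? Ns _ (λ {s} a →
                                                                trans (cong (length s *_) (ind-++-0 t a)) (*-zeroʳ (length s)))) ⟩
              S Ns (λ s → length s * ind (t ++ s))         ≤⟨ S-mono Ns (λ {s} s⊆ → ≤-trans (≤-reflexive (*-comm (length s) _))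
                                                                (*-monoʳ-≤ (ind (t ++ s)) (length≤X s⊆))) ⟩
              S Ns (λ s → ind (t ++ s) * X v (t ++ s)) ∎
              where
              length≤X : ∀ {s} → s ⊆ Ns → length s ≤ X v (t ++ s)
              length≤X {s} s⊆ = begin
                length s                                 ≡⟨ cong length (sym (filter-all (adj? v) (All-resp-⊆ s⊆ Ns-adj))) ⟩
                degree v s                               ≤⟨ m≤n+m _ (degree v t) ⟩
                degree v t + degree v s                  ≡⟨ sym (length-++ (filter (adj? v) t)) ⟩
                length (filter (adj? v) t ++ filter (adj? v) s) ≡⟨ cong length (sym (filter-++ (adj? v) t s)) ⟩
                degree v (t ++ s)                        ≤⟨ m≤n+m _ _ ⟩
                X v (t ++ s) ∎

            X-with-v : L ^ length Ns * Δ ≤ S Ns (λ s → ind (t ++ v ∷ s) * X v (t ++ v ∷ s))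
            X-with-v = ≤-trans (*-monoʳ-≤ (L ^ length Ns) (begin
              Δ                                              ≡⟨ sym (*-identityʳ Δ) ⟩
              Δ * 1                                          ≤⟨ *-monoʳ-≤ Δ (filter-some (_≟ v) (Any.++⁺ʳ t (here refl))) ⟩
              Δ * length (filter (_≟ v) (t ++ v ∷ []))       ≤⟨ m≤m+n _ _ ⟩
              X v (t ++ v ∷ [])                              ≡⟨ sym (*-identityˡ _) ⟩
              1 * X v (t ++ v ∷ [])                          ≡⟨ cong (_* X v (t ++ v ∷ [])) (sym (χ-yes (indep? (t ++ v ∷ []))
                                                                  (AllPairs.++⁺ it ([] ∷ []) (All.map (λ n → (n ∘ Adj-sym) ∷ []) tv)))) ⟩
              ind (t ++ v ∷ []) * X v (t ++ v ∷ []) ∎))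
              (S-lower Ns (λ s → ind (t ++ v ∷ s) * X v (t ++ v ∷ s)))

            lem₁ : ∀ τ L q z k → τ * (L * (q * z) + q * k) ≡ q * (τ * (L * z + k))
            lem₁ = solve-∀
            lem₂ : ∀ L q m k d → q * (L * m + k * d) ≡ L * (q * m) + q * k * d
            lem₂ = solve-∀

        -- Reordering `Vs` as non-neighbours, then `v` with its neighbours, turns `S-++` into
        -- conditioning on the set outside the closed neighbourhood.
        vertex-bound : ∀ {v} → v ∈ Vs → τ * Z Vs ≤ S Vs (λ s → ind s * X v s)
        vertex-bound {v} v∈Vs with ys , zs , refl ← ∈-∃++ v∈Vs = begin
          τ * Z Vs                                  ≡⟨ cong (τ *_) (S-resp-↭ ind-↭ Vs↭) ⟩
          τ * S (Rs ++ v ∷ Ns) ind                  ≡⟨ cong (τ *_) (S-++ Rs (v ∷ Ns) ind) ⟩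
          τ * S Rs (λ t → S (v ∷ Ns) (λ s → ind (t ++ s))) ≡⟨ sym (S-* τ Rs _) ⟩
          S Rs (λ t → τ * S (v ∷ Ns) (λ s → ind (t ++ s)))
            ≤⟨ S-mono Rs (λ t⊆ → inner-bound Ns-adj Rs-nonadj Ns-unique Ns⊆Vs v∈Vs (All-resp-⊆ t⊆ Rs-nonadj)) ⟩
          S Rs (λ t → S (v ∷ Ns) (λ s → ind (t ++ s) * X v (t ++ s))) ≡⟨ sym (S-++ Rs (v ∷ Ns) _) ⟩
          S (Rs ++ v ∷ Ns) (λ s → ind s * X v s)    ≡⟨ sym (S-resp-↭ (λ p → cong₂ _*_ (ind-↭ p) (X-↭ v p)) Vs↭) ⟩
          S Vs (λ s → ind s * X v s) ∎
          where
          open ≤-Reasoning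
          Ws = ys ++ zs
          Ns = filter (adj? v) Ws
          Rs = filter (∁? (adj? v)) Ws
          Vs↭v∷Ws : Vs ↭ v ∷ Ws
          Vs↭v∷Ws = shift v ys zs
          Vs↭ : Vs ↭ Rs ++ v ∷ Ns
          Vs↭ = ↭-trans Vs↭v∷Ws (↭-trans (prep v (filter-split-↭ (adj? v) Ws)) (↭-sym (shift v Rs Ns)))
          Ns-adj = All.all-filter (adj? v) Ws
          Rs-nonadj = All.all-filter (∁? (adj? v)) Ws
          Ns-unique : Unique Ns
          Ns-unique = AllPairs.filter⁺ (adj? v) (AllPairs.tail (AllPairs-resp-↭ (λ ne → ne ∘ sym) Vs↭v∷Ws Vs-unique))
          Ns⊆Vs : All (_∈ Vs) Ns
          Ns⊆Vs = All.filter⁺ (adj? v) (All.tail (All-resp-↭ Vs↭v∷Ws (All.tabulate id)))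

        ∑X≤2Δ|s| : ∀ {s} → s ⊆ Vs → ∑ Vs (λ v → X v s) ≤ 2 * Δ * length s
        ∑X≤2Δ|s| {s} s⊆ = begin
          ∑ Vs (λ v → X v s)                               ≡⟨ ∑-+ Vs _ _ ⟩
          ∑ Vs (λ v → Δ * length (filter (_≟ v) s)) + ∑ Vs (λ v → degree v s)
            ≡⟨ cong₂ _+_ (trans (∑-* Δ Vs _) (cong (Δ *_) (∑-length-filter (λ v u → u ≟ v) Vs s)))
                         (∑-length-filter adj? Vs s) ⟩
          Δ * ∑ s (λ u → length (filter (u ≟_) Vs)) + ∑ s (λ u → length (filter (λ v → adj? v u) Vs))
            ≤⟨ +-mono-≤ (*-monoʳ-≤ Δ (∑-mono s (All.universal (λ u → Unique⇒count≤1 _≟_ Vs-unique u) s)))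
                        (∑-mono s (All-resp-⊆ s⊆ (All.tabulate (λ {u} → degrees u)))) ⟩
          Δ * ∑ s (λ _ → 1) + ∑ s (λ _ → Δ)                ≡⟨ cong₂ (λ a b → Δ * a + b) (∑-const 1 s) (∑-const Δ s) ⟩
          Δ * (length s * 1) + length s * Δ                ≡⟨ lem Δ (length s) ⟩
          2 * Δ * length s ∎
          where
          open ≤-Reasoning
          lem : ∀ d l → d * (l * 1) + l * d ≡ 2 * d * l
          lem = solve-∀

        -- The `suc` adds `Z Vs`, which is positive, and so provides the strictness that `S-witness`
        -- asks for. The factor `ind s` annihilates both sides on dependent lists, hence the witness
        -- is independent.
        strict : S Vs (λ s → ind s * (τ * length Vs)) < S Vs (λ s → ind s * suc (2 * Δ * length s))
        strict = begin-strict
          S Vs (λ s → ind s * (τ * length Vs))       ≡⟨ S-cong Vs (λ {s} _ → lem₁ (ind s) τ (length Vs)) ⟩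
          S Vs (λ s → length Vs * (τ * ind s))       ≡⟨ trans (S-* (length Vs) Vs _) (cong (length Vs *_) (S-* τ Vs ind)) ⟩
          length Vs * (τ * Z Vs)                     ≡⟨ sym (∑-const (τ * Z Vs) Vs) ⟩
          ∑ Vs (λ _ → τ * Z Vs)                      ≤⟨ ∑-mono Vs (All.tabulate vertex-bound) ⟩
          ∑ Vs (λ v → S Vs (λ s → ind s * X v s))    ≡⟨ sym (S-∑ Vs Vs (λ v s → ind s * X v s)) ⟩
          S Vs (λ s → ∑ Vs (λ v → ind s * X v s))    ≡⟨ S-cong Vs (λ {s} _ → ∑-* (ind s) Vs (λ v → X v s)) ⟩
          S Vs (λ s → ind s * ∑ Vs (λ v → X v s))    ≤⟨ S-mono Vs (λ {s} s⊆ → *-monoʳ-≤ (ind s) (∑X≤2Δ|s| s⊆)) ⟩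
          S Vs (λ s → ind s * (2 * Δ * length s))    <⟨ m<n+m _ (<-≤-trans (m^n>0 L (length Vs)) (L^n≤Z Vs)) ⟩
          Z Vs + S Vs (λ s → ind s * (2 * Δ * length s)) ≡⟨ sym (S-+ Vs ind _) ⟩
          S Vs (λ s → ind s + ind s * (2 * Δ * length s)) ≡⟨ S-cong Vs (λ {s} _ → sym (*-suc (ind s) _)) ⟩
          S Vs (λ s → ind s * suc (2 * Δ * length s)) ∎
          where
          open ≤-Reasoning
          lem₁ : ∀ i t n → i * (t * n) ≡ n * (t * i)
          lem₁ = solve-∀

        large-independent-set : ∃ λ I → I ⊆ Vs × Indep I × τ * length Vs ≤ 2 * Δ * length I
        large-independent-set with I , I⊆ , lt ← S-witness Vs {λ s → ind s * (τ * length Vs)} {λ s → ind s * suc (2 * Δ * length s)} strict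
                              with indep? I
        ... | yes i = I , I⊆ , i , s≤s⁻¹ (subst₂ _<_ (+-identityʳ _) (+-identityʳ _) lt)
        ... | no _ = contradiction lt (λ ())

-- Counting by unions and fibres

-- A bound on the cardinality of `Q`, expressed through duplicate-free lists so that no enumeration
-- of `Q` has to be produced.
Bounded : (A → Set) → ℕ → Set
Bounded Q M = ∀ xs → Unique xs → All Q xs → length xs ≤ M

Bounded-mono : ∀ {Q Q′ : A → Set} {M M′} → (∀ {x} → Q′ x → Q x) → M ≤ M′ → Bounded Q M → Bounded Q′ M′
Bounded-mono f M≤M′ b xs u q = ≤-trans (b xs u (All.map f q)) M≤M′

Bounded-∅ : ∀ {Q : A → Set} {M} → (∀ {x} → ¬ Q x) → Bounded Q M
Bounded-∅ f [] _ _ = z≤n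
Bounded-∅ f (x ∷ xs) _ (q ∷ _) = contradiction q f

partition-⊎ : ∀ {Q Q₁ Q₂ : A → Set} → (∀ {x} → Q x → Q₁ x ⊎ Q₂ x) → ∀ {xs} → All Q xs →
              ∃ λ ys → ∃ λ zs → ys ⊆ xs × zs ⊆ xs × All Q₁ ys × All Q₂ zs × length xs ≡ length ys + length zs
partition-⊎ f [] = [] , [] , [] , [] , [] , [] , refl
partition-⊎ f {x ∷ _} (q ∷ qs) with ys , zs , ys⊆ , zs⊆ , q₁ , q₂ , eq ← partition-⊎ f qs with f q
... | inj₁ r = x ∷ ys , zs , refl ∷ ys⊆ , x ∷ʳ zs⊆ , r ∷ q₁ , q₂ , cong suc eq
... | inj₂ r = ys , x ∷ zs , x ∷ʳ ys⊆ , refl ∷ zs⊆ , q₁ , r ∷ q₂ ,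
               trans (cong suc eq) (sym (+-suc (length ys) (length zs)))

Bounded-⊎ : ∀ {Q Q₁ Q₂ : A → Set} {M₁ M₂} → (∀ {x} → Q x → Q₁ x ⊎ Q₂ x) →
            Bounded Q₁ M₁ → Bounded Q₂ M₂ → Bounded Q (M₁ + M₂)
Bounded-⊎ f b₁ b₂ xs u q with ys , zs , ys⊆ , zs⊆ , q₁ , q₂ , eq ← partition-⊎ f q =
  ≤-trans (≤-reflexive eq) (+-mono-≤ (b₁ ys (AllPairs-resp-⊆ ys⊆ u) q₁) (b₂ zs (AllPairs-resp-⊆ zs⊆ u) q₂))

Bounded-⋃ : ∀ {R : B → A → Set} {M} ys → (∀ {y} → y ∈ ys → Bounded (R y) M) →
            Bounded (λ x → Any (λ y → R y x) ys) (length ys * M)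
Bounded-⋃ [] b = Bounded-∅ (λ ())
Bounded-⋃ (y ∷ ys) b = Bounded-⊎ (λ { (here r) → inj₁ r ; (there a) → inj₂ a })
                         (b (here refl)) (Bounded-⋃ ys (b ∘ there))

Bounded-inj : ∀ {Q : A → Set} {Q′ : B → Set} {M} (f : A → B) →
              (∀ {x y} → Q x → Q y → f x ≡ f y → x ≡ y) → (∀ {x} → Q x → Q′ (f x)) →
              Bounded Q′ M → Bounded Q M
Bounded-inj {Q = Q} f inj h b xs u q =
  ≤-trans (≤-reflexive (sym (length-map f xs))) (b (map f xs) (unique u q) (All.map⁺ (All.map h q)))
  where
  unique : ∀ {xs} → Unique xs → All Q xs → Unique (map f xs)
  unique [] [] = []
  unique (n ∷ u) (q ∷ qs) = All.map⁺ (All.zipWith (λ (ne , q′) eq → ne (inj q q′ eq)) (n , qs)) ∷ unique u qs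

-- The pairs are grouped by the distinct first components that occur.
Bounded-× : ∀ {Q : A → Set} {R : A → B → Set} {M₁ M₂} → DecidableEquality A →
            Bounded Q M₁ → (∀ {x} → Q x → Bounded (R x) M₂) →
            Bounded (λ (x , y) → Q x × R x y) (M₁ * M₂)
Bounded-× {Q = Q} {R} {M₁} {M₂} _≟_ b₁ b₂ xs u q =
  ≤-trans
    (Bounded-⋃ {R = λ a (x , y) → x ≡ a × Q x × R x y} fs
      (λ {a} _ → Bounded-fibre a) xs u
      (All.tabulate (λ {p} p∈ → lose (∈-deduplicate⁺ _≟_ (∈-map⁺ proj₁ p∈)) (refl , All.lookup q p∈))))
    (*-monoˡ-≤ M₂ (b₁ fs (UniqueDec.deduplicate-! _≟_ (map proj₁ xs))
      (All.tabulate (λ a∈ → Q-first (∈-map⁻ proj₁ (∈-deduplicate⁻ _≟_ (map proj₁ xs) a∈))))))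
  where
  fs = deduplicate _≟_ (map proj₁ xs)
  Q-first : ∀ {a} → ∃ (λ p → p ∈ xs × a ≡ proj₁ p) → Q a
  Q-first (p , p∈ , refl) = proj₁ (All.lookup q p∈)
  Bounded-fibre : ∀ a → Bounded (λ (x , y) → x ≡ a × Q x × R x y) M₂
  Bounded-fibre a [] _ _ = z≤n
  Bounded-fibre a (p ∷ ps) u′ (h@(refl , qa , _) ∷ hs) =
    Bounded-inj {Q = λ (x , y) → x ≡ a × Q x × R x y} proj₂
      (λ { (refl , _) (refl , _) refl → refl }) (λ { (refl , _ , r) → r }) (b₂ qa) (p ∷ ps) u′ (h ∷ hs)

module _ {P : Pred I 0ℓ} (P? : Decidable P) where

  count : List I → ℕ
  count xs = length (filter P? xs)

  count-↭ : ∀ {xs ys} → xs ↭ ys → count xs ≡ count ys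
  count-↭ p = ↭-length (filter-↭ P? p)

  count-rest : ∀ {xs ch rest} → xs ↭ ch ++ rest → All (¬_ ∘ P) ch → count xs ≡ count rest
  count-rest {xs} {ch} {rest} p n = trans (count-↭ p) (cong length
    (trans (filter-++ P? ch rest) (cong (_++ filter P? rest) (filter-none P? n))))

count-⊎ : ∀ {P Q R : Pred I 0ℓ} (P? : Decidable P) (Q? : Decidable Q) (R? : Decidable R) →
          (∀ {i} → P i → Q i ⊎ R i) → ∀ xs → count P? xs ≤ count Q? xs + count R? xs
count-⊎ P? Q? R? f [] = z≤n
count-⊎ P? Q? R? f (x ∷ xs) with ih ← count-⊎ P? Q? R? f xs with P? x | Q? x | R? x
... | no _  | yes _ | yes _ = ≤-trans ih (+-mono-≤ (n≤1+n _) (n≤1+n _))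
... | no _  | yes _ | no _ = ≤-trans ih (n≤1+n _)
... | no _  | no _ | yes _ = ≤-trans ih (+-monoʳ-≤ (count Q? xs) (n≤1+n _))
... | no _  | no _ | no _ = ih
... | yes _ | yes _ | yes _ = s≤s (≤-trans ih (+-monoʳ-≤ (count Q? xs) (n≤1+n _)))
... | yes _ | yes _ | no _ = s≤s ih
... | yes _ | no _ | yes _ = ≤-trans (s≤s ih) (≤-reflexive (sym (+-suc (count Q? xs) (count R? xs))))
... | yes p | no ¬q | no ¬r with f p
...   | inj₁ q = contradiction q ¬q
...   | inj₂ r = contradiction r ¬r

nC0≡1 : ∀ n → n C 0 ≡ 1
nC0≡1 n = trans (nCk≡nC[n∸k] {0} {n} z≤n) (nCn≡1 n)

-- A union bound over the first `k` positions at which `P x` holds: the head of the list is taken or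
-- skipped according to `P`, and Pascal's rule adds the two branches. The complement `rest` is
-- handed on so that further choices can be made from it.
choose-bound : ∀ {P : A → I → Set} (P? : ∀ x i → Dec (P x i)) {M} xs {l} k → length xs ≡ l → {Q : A → Set} →
               (∀ {x} → Q x → k ≤ count (P? x) xs) →
               (∀ ch rest → xs ↭ ch ++ rest → length ch ≡ k → Bounded (λ x → Q x × All (P x) ch) M) →
               Bounded Q ((l C k) * M)
choose-bound P? {M} xs zero refl h b =
  Bounded-mono (λ q → q , []) (≤-reflexive (sym (trans (cong (_* M) (nC0≡1 (length xs))) (+-identityʳ M))))
    (b [] xs ↭-refl refl)
choose-bound P? [] (suc k) refl h b = Bounded-∅ (λ q → contradiction (h q) (λ ()))
choose-bound {P = P} P? {M} (y ∷ xs) (suc k) refl {Q} h b =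
  Bounded-mono id
    (≤-reflexive (trans (sym (*-distribʳ-+ M (n C k) (n C suc k))) (cong (_* M) (nCk+nC[k+1]≡[n+1]C[k+1] n k))))
    (Bounded-⊎ {Q₁ = λ x → Q x × P x y} {Q₂ = λ x → Q x × ¬ P x y} split
      (choose-bound P? xs k refl (λ (q , p) → tail-yes q p)
        (λ ch rest xs↭ eq → Bounded-mono (λ ((q , p) , a) → q , p ∷ a) ≤-refl
          (b (y ∷ ch) rest (prep y xs↭) (cong suc eq))))
      (choose-bound P? xs (suc k) refl (λ (q , p) → tail-no q p)
        (λ ch rest xs↭ eq → Bounded-mono (λ ((q , _) , a) → q , a) ≤-refl
          (b ch (y ∷ rest) (↭-trans (prep y xs↭) (↭-sym (shift y ch rest))) eq))))
  where
  n = length xs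
  split : ∀ {x} → Q x → (Q x × P x y) ⊎ (Q x × ¬ P x y)
  split {x} q with P? x y
  ... | yes p = inj₁ (q , p)
  ... | no ¬p = inj₂ (q , ¬p)
  tail-yes : ∀ {x} → Q x → P x y → k ≤ count (P? x) xs
  tail-yes {x} q p with hq ← h q rewrite filter-accept (P? x) {xs = xs} p = s≤s⁻¹ hq
  tail-no : ∀ {x} → Q x → ¬ P x y → suc k ≤ count (P? x) xs
  tail-no {x} q p with hq ← h q rewrite filter-reject (P? x) {xs = xs} p = hq

-- Permutations with prescribed agreements

Word : ℕ → Set
Word n = Vec (Fin n) n

IsPerm : ∀ {n} → Word n → Set
IsPerm σ = ∀ i j → lookup σ i ≡ lookup σ j → i ≡ j

lookup-ext : ∀ {n} {σ τ : Word n} → (∀ i → lookup σ i ≡ lookup τ i) → σ ≡ τ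
lookup-ext {σ = σ} {τ} h = trans (sym (tabulate∘lookup σ)) (trans (tabulate-cong h) (tabulate∘lookup τ))

injective⇒surjective : ∀ {n} (f : Fin n → Fin n) → (∀ i j → f i ≡ f j → i ≡ j) → ∀ y → ∃ λ i → f i ≡ y
injective⇒surjective {suc n} f inj y with Fin.any? (λ i → f i Fin.≟ y)
... | yes h = h
... | no h = contradiction
  (injective⇒≤ {f = λ i → punchOut (y≢ i)} (λ {i} {j} eq → inj i j (punchOut-injective (y≢ i) (y≢ j) eq)))
  1+n≰n
  where
  y≢ : ∀ i → y ≢ f i
  y≢ i eq = h (i , sym eq)

allFin-split : ∀ {n} (ch rest : List (Fin n)) → allFin n ↭ ch ++ rest →
               (∀ i → i ∈ ch ⊎ i ∈ rest) × Unique rest × (∀ {i} → i ∈ ch → i ∈ rest → ⊥) × n ≡ length ch + length rest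
allFin-split {n} ch rest p =
  (λ i → ∈-++⁻ ch (∈-resp-↭ p (∈-allFin i))) , AllPairs-++⁻ʳ ch u , disjoint ch u ,
  trans (sym (length-tabulate id)) (trans (↭-length p) (length-++ ch))
  where
  u : Unique (ch ++ rest)
  u = AllPairs-resp-↭ (λ ne → ne ∘ sym) p (Unique.allFin⁺ n)
  disjoint : ∀ ch → Unique (ch ++ rest) → ∀ {i} → i ∈ ch → i ∈ rest → ⊥
  disjoint (x ∷ ch) (h ∷ _) (here refl) i∈ = All.lookup (All.++⁻ʳ ch h) i∈ refl
  disjoint (x ∷ ch) (_ ∷ u) (there i∈ch) i∈ = disjoint ch u i∈ch i∈

-- The positions in `Ps` are filled one at a time. By injectivity a value once used can be struck
-- from `Ys`, so the number of choices drops by one at each position.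
values-bound : ∀ {n} (Ps Ys : List (Fin n)) → length Ys ≤ length Ps → Unique Ps → {Q : Word n → Set} →
               (∀ {σ} → Q σ → IsPerm σ) → (∀ {σ} → Q σ → All (λ i → lookup σ i ∈ Ys) Ps) →
               (∀ {σ τ} → Q σ → Q τ → ∀ i → i ∈ Ps ⊎ lookup σ i ≡ lookup τ i) →
               Bounded Q (length Ps !)
values-bound [] Ys _ _ perm val agree [] _ _ = z≤n
values-bound [] Ys _ _ perm val agree (σ ∷ []) _ _ = ≤-refl
values-bound [] Ys _ _ perm val agree (σ ∷ τ ∷ _) ((ne ∷ _) ∷ _) (q ∷ q′ ∷ _) =
  contradiction (lookup-ext (λ i → [ (λ ()) , id ]′ (agree q q′ i))) ne
values-bound (i ∷ Ps) Ys le (i∉ ∷ u) {Q} perm val agree =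
  Bounded-mono (λ q → Any.map (λ eq → q , eq) (All.head (val q))) (*-monoˡ-≤ (length Ps !) le)
    (Bounded-⋃ {R = λ y σ → Q σ × lookup σ i ≡ y} Ys (λ {y} y∈ →
      values-bound Ps (filter (λ z → ¬? (z Fin.≟ y)) Ys)
        (s≤s⁻¹ (≤-trans (filter-notAll (λ z → ¬? (z Fin.≟ y)) Ys (Any.map (λ eq ne → ne (sym eq)) y∈)) le)) u
        (perm ∘ proj₁)
        (λ { {σ} (q , refl) → All.zipWith (λ { {j} (ne , v) → ∈-filter⁺ (λ z → ¬? (z Fin.≟ _)) v
                                                (λ eq → ne (sym (perm q j i eq))) })
                                          (i∉ , All.tail (val q)) })
        (λ { (q , refl) (q′ , eq) j → agree′ q q′ eq j (agree q q′ j) })))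
  where
  agree′ : ∀ {σ τ} → Q σ → Q τ → lookup τ i ≡ lookup σ i → ∀ j →
           j ∈ i ∷ Ps ⊎ lookup σ j ≡ lookup τ j → j ∈ Ps ⊎ lookup σ j ≡ lookup τ j
  agree′ q q′ eq j (inj₁ (here refl)) = inj₂ (sym eq)
  agree′ q q′ eq j (inj₁ (there j∈)) = inj₁ j∈
  agree′ q q′ eq j (inj₂ e) = inj₂ e

-- The first member is the reference: another member has the same values on `ch`, so by injectivity
-- its values on `rest` are those of the reference there. As members are compared only with each
-- other, the values prescribed on `ch` may come from several words.
agree-bound : ∀ {n k} {ch rest : List (Fin n)} → allFin n ↭ ch ++ rest → length rest ≡ k → {Q : Word n → Set} →
              (∀ {σ} → Q σ → IsPerm σ) →
              (∀ {σ τ} → Q σ → Q τ → All (λ i → lookup σ i ≡ lookup τ i) ch) →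
              Bounded Q (k !)
agree-bound p _ perm agree [] _ _ = z≤n
agree-bound {n} {_} {ch} {rest} p refl {Q} perm agree (σ ∷ σs) u (q ∷ qs) with cover , rest-u , disj , _ ← allFin-split ch rest p =
  values-bound rest (map (lookup σ) rest) (≤-reflexive (length-map (lookup σ) rest)) rest-u perm
    (λ {τ} q′ → All.tabulate (λ {j} j∈ → value q′ j∈))
    (λ q₁ q₂ i → [ (λ i∈ → inj₂ (All.lookup (agree q₁ q₂) i∈)) , inj₁ ]′ (cover i))
    (σ ∷ σs) u (q ∷ qs)
  where
  value : ∀ {τ} → Q τ → ∀ {j} → j ∈ rest → lookup τ j ∈ map (lookup σ) rest
  value {τ} q′ {j} j∈ with j′ , eq ← injective⇒surjective (lookup σ) (perm q) (lookup τ j) with cover j′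
  ... | inj₂ j′∈ = subst (_∈ map (lookup σ) rest) eq (∈-map⁺ (lookup σ) j′∈)
  ... | inj₁ j′∈ with refl ← perm q′ j′ j (trans (sym (All.lookup (agree q q′) j′∈)) eq) =
    contradiction j∈ (disj j′∈)

agree? : ∀ {n} (σ τ : Word n) i → Dec (lookup σ i ≡ lookup τ i)
agree? σ τ i = lookup σ i Fin.≟ lookup τ i

agreement : ∀ {n} → Word n → Word n → ℕ
agreement {n} σ τ = count (agree? σ τ) (allFin n)

ball-bound : ∀ m r (σ : Word (m + r)) →
             Bounded (λ τ → IsPerm τ × m ≤ agreement σ τ) (((m + r) C m) * r !)
ball-bound m r σ =
  choose-bound (agree? σ) (allFin (m + r)) m (length-tabulate id) proj₂ (λ ch rest p len →
    agree-bound p (rest-length ch rest p len) {λ τ → (IsPerm τ × m ≤ agreement σ τ) × All (λ i → lookup σ i ≡ lookup τ i) ch}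
      (proj₁ ∘ proj₁) (λ (_ , a) (_ , b) → All.zipWith (λ (x , y) → trans (sym x) y) (a , b)))
  where
  rest-length : ∀ (ch rest : List (Fin (m + r))) → allFin (m + r) ↭ ch ++ rest → length ch ≡ m → length rest ≡ r
  rest-length ch rest p len = +-cancelˡ-≡ m (length rest) r
    (trans (cong (_+ length rest) (sym len)) (sym (proj₂ (proj₂ (proj₂ (allFin-split ch rest p))))))

module _ {n} (σ : Word n) where

  AllAgree Onlyστ Onlyσρ Onlyτρ : Word n × Word n → Fin n → Set
  AllAgree (τ , ρ) i = lookup σ i ≡ lookup τ i × lookup σ i ≡ lookup ρ i
  Onlyστ (τ , ρ) i = lookup σ i ≡ lookup τ i × lookup σ i ≢ lookup ρ i
  Onlyσρ (τ , ρ) i = lookup σ i ≡ lookup ρ i × lookup σ i ≢ lookup τ i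
  Onlyτρ (τ , ρ) i = lookup τ i ≡ lookup ρ i × lookup σ i ≢ lookup τ i

  allAgree? : ∀ z i → Dec (AllAgree z i)
  allAgree? (τ , ρ) i = agree? σ τ i ×-dec agree? σ ρ i
  onlyστ? : ∀ z i → Dec (Onlyστ z i)
  onlyστ? (τ , ρ) i = agree? σ τ i ×-dec ¬? (agree? σ ρ i)
  onlyσρ? : ∀ z i → Dec (Onlyσρ z i)
  onlyσρ? (τ , ρ) i = agree? σ ρ i ×-dec ¬? (agree? σ τ i)
  onlyτρ? : ∀ z i → Dec (Onlyτρ z i)
  onlyτρ? (τ , ρ) i = agree? τ ρ i ×-dec ¬? (agree? σ τ i)

  Triangle : ℕ → Word n × Word n → Set
  Triangle m (τ , ρ) = (IsPerm τ × m ≤ agreement σ τ) × (IsPerm ρ × m ≤ agreement σ ρ) × m ≤ agreement τ ρ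

  -- Lower bounds rather than exact sizes, as this is what `choose-bound` consumes.
  Typed : ℕ → ℕ → Word n × Word n → Set
  Typed t j z@(τ , ρ) = (IsPerm τ × IsPerm ρ) × t ≤ count (allAgree? z) (allFin n) ×
    j ≤ count (onlyστ? z) (allFin n) × j ≤ count (onlyσρ? z) (allFin n) × j ≤ count (onlyτρ? z) (allFin n)

  -- Each pair agrees in `m` positions, and those not common to all three words are exclusive to the
  -- pair. Truncated subtraction covers more than `m` common agreements: then j = 0 and `m ∸ j` is
  -- `m`.
  Triangle⇒Typed : ∀ {m z} → Triangle m z → let j = m ∸ count (allAgree? z) (allFin n) in Typed (m ∸ j) j z
  Triangle⇒Typed {m} {z@(τ , ρ)} ((τ-perm , στ) , (ρ-perm , σρ) , τρ) =
    (τ-perm , ρ-perm) ,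
    m≤n+o⇒m∸n≤o m (m ∸ t) (≤-trans (m≤n+m∸n m t) (≤-reflexive (+-comm t _))) ,
    m≤n+o⇒m∸n≤o m t (≤-trans στ (count-⊎ (agree? σ τ) (allAgree? z) (onlyστ? z) στ-split (allFin n))) ,
    m≤n+o⇒m∸n≤o m t (≤-trans σρ (count-⊎ (agree? σ ρ) (allAgree? z) (onlyσρ? z) σρ-split (allFin n))) ,
    m≤n+o⇒m∸n≤o m t (≤-trans τρ (count-⊎ (agree? τ ρ) (allAgree? z) (onlyτρ? z) τρ-split (allFin n)))
    where
    t = count (allAgree? z) (allFin n)
    στ-split : ∀ {i} → lookup σ i ≡ lookup τ i → AllAgree z i ⊎ Onlyστ z i
    στ-split {i} eq with agree? σ ρ i
    ... | yes e = inj₁ (eq , e)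
    ... | no ne = inj₂ (eq , ne)
    σρ-split : ∀ {i} → lookup σ i ≡ lookup ρ i → AllAgree z i ⊎ Onlyσρ z i
    σρ-split {i} eq with agree? σ τ i
    ... | yes e = inj₁ (e , eq)
    ... | no ne = inj₂ (eq , ne)
    τρ-split : ∀ {i} → lookup τ i ≡ lookup ρ i → AllAgree z i ⊎ Onlyτρ z i
    τρ-split {i} eq with agree? σ τ i
    ... | yes e = inj₁ (e , trans e eq)
    ... | no ne = inj₂ (eq , ne)

  -- The four kinds of position exclude each other, so sets T, A, B, C of these kinds can be chosen
  -- successively, each from what the earlier ones leave. Then τ is prescribed on T and A, which
  -- leaves r positions; given τ, ρ is prescribed on T, B and C, which leaves only r - j. This last
  -- drop is the source of the saving.
  Typed-bound : ∀ t j r → n ≡ t + j + r →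
                Bounded (Typed t j) ((n C t) * (((r + j) C j) * ((r C j) * (((r ∸ j) C j) * (r ! * (r ∸ j) !)))))
  Typed-bound t j r n≡ =
    choose-bound allAgree? (allFin n) t (length-tabulate {n = n} id) {Typed t j} (proj₁ ∘ proj₂) λ chT R₁ pT lenT →
      let len₁ = +-cancelˡ-≡ t (length R₁) (r + j) (trans (cong (_+ length R₁) (sym lenT))
                   (trans (sym (proj₂ (proj₂ (proj₂ (allFin-split chT R₁ pT)))))
                     (trans n≡ (trans (+-assoc t j r) (cong (t +_) (+-comm j r))))))
          Q₁ = λ z → Typed t j z × All (AllAgree z) chT in
      choose-bound onlyστ? R₁ j len₁ {Q₁} (λ {z} (q , aT) → ≤-trans (proj₁ (proj₂ (proj₂ q)))
          (≤-reflexive (count-rest (onlyστ? z) pT (All.map (λ (_ , e) (_ , ne) → ne e) aT)))) λ chA R₂ pA lenA →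
        let len₂ = +-cancelˡ-≡ j (length R₂) r (trans (rest-length R₁ chA R₂ pA lenA) (trans len₁ (+-comm r j)))
            Q₂ = λ z → Q₁ z × All (Onlyστ z) chA in
        choose-bound onlyσρ? R₂ j len₂ {Q₂} (λ {z} ((q , aT) , aA) → ≤-trans (proj₁ (proj₂ (proj₂ (proj₂ q))))
            (≤-reflexive (trans (count-rest (onlyσρ? z) pT (All.map (λ (e , _) (_ , ne) → ne e) aT))
                                (count-rest (onlyσρ? z) pA (All.map (λ (e , _) (_ , ne) → ne e) aA))))) λ chB R₃ pB lenB →
          let len₃ = trans (sym (m+n∸m≡n j (length R₃))) (cong (_∸ j) (trans (rest-length R₂ chB R₃ pB lenB) len₂))
              Q₃ = λ z → Q₂ z × All (Onlyσρ z) chB in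
          choose-bound onlyτρ? R₃ j len₃ {Q₃} (λ {z} (((q , aT) , aA) , aB) → ≤-trans (proj₂ (proj₂ (proj₂ (proj₂ q))))
              (≤-reflexive (trans (count-rest (onlyτρ? z) pT (All.map (λ (e , _) (_ , ne) → ne e) aT))
                           (trans (count-rest (onlyτρ? z) pA (All.map (λ (e , _) (_ , ne) → ne e) aA))
                                  (count-rest (onlyτρ? z) pB (All.map (λ (e , _) (e′ , ne) → ne (trans e (sym e′))) aB)))))) λ chC R₄ pC lenC →
            let len₄ : length (chA ++ R₄) ≡ r ∸ j
                len₄ = trans (length-++ chA) (trans (cong (_+ length R₄) lenA)
                         (trans (rest-length R₃ chC R₄ pC lenC) len₃))
                p₁ : allFin n ↭ (chT ++ chA) ++ R₂
                p₁ = ↭-trans pT (↭-trans (++⁺ˡ chT pA) (↭-reflexive (sym (++-assoc chT chA R₂))))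
                -- The positions in `chA` rejoin the free ones: the value of ρ there is not
                -- prescribed.
                p₂ : allFin n ↭ (chT ++ chB ++ chC) ++ chA ++ R₄
                p₂ = ↭-trans pT (↭-trans (++⁺ˡ chT
                       (↭-trans pA (↭-trans (++⁺ˡ chA (↭-trans pB (++⁺ˡ chB pC)))
                         (↭-trans (shifts chA chB) (++⁺ˡ chB (shifts chA chC))))))
                       (↭-reflexive (trans (cong (chT ++_) (sym (++-assoc chB chC _))) (sym (++-assoc chT (chB ++ chC) _)))))
                Qτ = λ τ → IsPerm τ × All (λ i → lookup σ i ≡ lookup τ i) (chT ++ chA)
                Qρ = λ τ ρ → IsPerm ρ × All (λ i → lookup σ i ≡ lookup ρ i) chT ×
                       All (λ i → lookup σ i ≡ lookup ρ i) chB × All (λ i → lookup τ i ≡ lookup ρ i) chC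
            in
            Bounded-mono {Q = λ (τ , ρ) → Qτ τ × Qρ τ ρ}
              (λ {z} ((((((τ-perm , ρ-perm) , _) , aT) , aA) , aB) , aC) →
                (τ-perm , All.++⁺ (All.map proj₁ aT) (All.map proj₁ aA)) ,
                (ρ-perm , All.map proj₂ aT , All.map proj₁ aB , All.map proj₁ aC))
              ≤-refl
              (Bounded-× {Q = Qτ} {R = Qρ} (≡-dec Fin._≟_)
                (agree-bound p₁ len₂ {Qτ} proj₁ (λ (_ , a) (_ , b) → agreed a b))
                (λ {τ} _ → agree-bound p₂ len₄ {Qρ τ} proj₁
                  (λ (_ , a , b , c) (_ , a′ , b′ , c′) → All.++⁺ (agreed a a′) (All.++⁺ (agreed b b′) (agreed c c′)))))
    where
    rest-length : ∀ (xs ch rest : List (Fin n)) {k} → xs ↭ ch ++ rest → length ch ≡ k → k + length rest ≡ length xs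
    rest-length xs ch rest p len = trans (cong (_+ length rest) (sym len)) (trans (sym (length-++ ch)) (sym (↭-length p)))
    agreed : ∀ {f g h : Fin n → Fin n} {ch} → All (λ i → f i ≡ g i) ch → All (λ i → f i ≡ h i) ch → All (λ i → g i ≡ h i) ch
    agreed a b = All.zipWith (λ (x , y) → trans (sym x) y) (a , b)

-- Binomial estimates

binomial-factorial : ∀ a b → ((a + b) C a) * (a ! * b !) ≡ (a + b) !
binomial-factorial a b = begin
  ((a + b) C a) * (a ! * b !)              ≡⟨ cong (λ x → ((a + b) C a) * (a ! * x !)) (sym (m+n∸m≡n a b)) ⟩
  ((a + b) C a) * (a ! * (a + b ∸ a) !)    ≡⟨ cong (_* (a ! * (a + b ∸ a) !)) (nCk≡n!/k![n-k]! (m≤m+n a b)) ⟩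
  _                                        ≡⟨ m/n*n≡m (k![n∸k]!∣n! (m≤m+n a b)) ⟩
  (a + b) ! ∎
  where
  open ≡-Reasoning
  instance _ = a !* (a + b ∸ a) !≢0

-- Both sides are the multinomial coefficient n! / (t! j! r!).
binomial-trinomial : ∀ t j r → ((t + j + r) C t) * ((r + j) C j) ≡ ((t + j + r) C (t + j)) * ((t + j) C j)
binomial-trinomial t j r = *-cancelʳ-≡ _ _ (t ! * (j ! * r !)) {{m*n≢0 (t !) (j ! * r !) {{t !≢0}} {{j !* r !≢0}}}} (begin
  ((n C t) * ((r + j) C j)) * (t ! * (j ! * r !))  ≡⟨ lem₁ (n C t) ((r + j) C j) (t !) (j !) (r !) ⟩
  (n C t) * (t ! * (((r + j) C j) * (j ! * r !)))  ≡⟨ cong (λ x → (n C t) * (t ! * ((x C j) * (j ! * r !)))) (+-comm r j) ⟩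
  (n C t) * (t ! * (((j + r) C j) * (j ! * r !)))  ≡⟨ cong (λ x → (n C t) * (t ! * x)) (binomial-factorial j r) ⟩
  (n C t) * (t ! * (j + r) !)                      ≡⟨ cong (λ x → (x C t) * (t ! * (j + r) !)) (+-assoc t j r) ⟩
  ((t + (j + r)) C t) * (t ! * (j + r) !)          ≡⟨ binomial-factorial t (j + r) ⟩
  (t + (j + r)) !                                  ≡⟨ cong _! (sym (+-assoc t j r)) ⟩
  n !                                              ≡⟨ sym (binomial-factorial (t + j) r) ⟩
  (n C (t + j)) * ((t + j) ! * r !)                ≡⟨ cong (λ x → (n C (t + j)) * (x * r !)) m! ⟩
  (n C (t + j)) * (((t + j) C j) * (j ! * t !) * r !) ≡⟨ lem₂ (n C (t + j)) ((t + j) C j) (t !) (j !) (r !) ⟩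
  ((n C (t + j)) * ((t + j) C j)) * (t ! * (j ! * r !)) ∎)
  where
  open ≡-Reasoning
  n = t + j + r
  m! : (t + j) ! ≡ ((t + j) C j) * (j ! * t !)
  m! = trans (cong _! (+-comm t j)) (trans (sym (binomial-factorial j t)) (cong (λ x → (x C j) * (j ! * t !)) (+-comm j t)))
  lem₁ : ∀ a b x y z → (a * b) * (x * (y * z)) ≡ a * (x * (b * (y * z)))
  lem₁ = solve-∀
  lem₂ : ∀ a b x y z → a * (b * (y * x) * z) ≡ (a * b) * (x * (y * z))
  lem₂ = solve-∀

nCk≤[1+n]Ck : ∀ n k → n C k ≤ suc n C k
nCk≤[1+n]Ck n zero = ≤-reflexive (trans (nC0≡1 n) (sym (nC0≡1 (suc n))))
nCk≤[1+n]Ck n (suc k) = ≤-trans (m≤n+m (n C suc k) (n C k)) (≤-reflexive (nCk+nC[k+1]≡[n+1]C[k+1] n k))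

nCk≤[i+n]Ck : ∀ i n k → n C k ≤ (i + n) C k
nCk≤[i+n]Ck zero n k = ≤-refl
nCk≤[i+n]Ck (suc i) n k = ≤-trans (nCk≤[i+n]Ck i n k) (nCk≤[1+n]Ck (i + n) k)

-- The upper index of the binomial is raised from w to j + w. With w = r - j this bounds the choices
-- of C and the completions of ρ together by r! / j!.
wCj*w!*j!≤[j+w]! : ∀ j w → (w C j) * w ! * j ! ≤ (j + w) !
wCj*w!*j!≤[j+w]! j w = begin
  (w C j) * w ! * j !           ≡⟨ trans (*-assoc (w C j) (w !) (j !)) (cong ((w C j) *_) (*-comm (w !) (j !))) ⟩
  (w C j) * (j ! * w !)         ≤⟨ *-monoˡ-≤ (j ! * w !) (nCk≤[i+n]Ck j w j) ⟩
  ((j + w) C j) * (j ! * w !)   ≡⟨ binomial-factorial j w ⟩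
  (j + w) ! ∎
  where open ≤-Reasoning

-- One term of the binomial expansion of (1 + Y) ^ m, multiplied by Y ^ j so that no subtraction occurs.
mCj*Y^m≤Y^j*[1+Y]^m : ∀ Y m j → (m C j) * Y ^ m ≤ Y ^ j * (1 + Y) ^ m
mCj*Y^m≤Y^j*[1+Y]^m Y m zero = ≤-trans
  (≤-reflexive (trans (cong (_* Y ^ m) (nC0≡1 m)) (*-identityˡ _)))
  (≤-trans (^-monoˡ-≤ m (n≤1+n Y)) (≤-reflexive (sym (*-identityˡ _))))
mCj*Y^m≤Y^j*[1+Y]^m Y zero (suc j) = z≤n
mCj*Y^m≤Y^j*[1+Y]^m Y (suc m) (suc j) = begin
  (suc m C suc j) * (Y * Y ^ m)                   ≡⟨ cong (_* (Y * Y ^ m)) (sym (nCk+nC[k+1]≡[n+1]C[k+1] m j)) ⟩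
  ((m C j) + (m C suc j)) * (Y * Y ^ m)           ≡⟨ lem₁ (m C j) (m C suc j) Y (Y ^ m) ⟩
  Y * ((m C j) * Y ^ m) + Y * ((m C suc j) * Y ^ m)
    ≤⟨ +-mono-≤ (*-monoʳ-≤ Y (mCj*Y^m≤Y^j*[1+Y]^m Y m j)) (*-monoʳ-≤ Y (mCj*Y^m≤Y^j*[1+Y]^m Y m (suc j))) ⟩
  Y * (Y ^ j * (1 + Y) ^ m) + Y * (Y * Y ^ j * (1 + Y) ^ m) ≡⟨ lem₂ Y (Y ^ j) ((1 + Y) ^ m) ⟩
  Y * Y ^ j * ((1 + Y) * (1 + Y) ^ m) ∎
  where
  open ≤-Reasoning
  lem₁ : ∀ a b y k → (a + b) * (y * k) ≡ y * (a * k) + y * (b * k)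
  lem₁ = solve-∀
  lem₂ : ∀ y a k → y * (a * k) + y * (y * a * k) ≡ y * a * ((1 + y) * k)
  lem₂ = solve-∀

-- A crude z^j / j! ≤ e^z with z^z in place of e^z: for j > z the last j - z factors of j! all
-- exceed z.
z^j≤j!*z^z : ∀ z .{{_ : NonZero z}} j → z ^ j ≤ j ! * z ^ z
z^j≤j!*z^z z j with ≤-total j z
... | inj₁ j≤z = ≤-trans (^-monoʳ-≤ z j≤z) (m≤n*m (z ^ z) (j !) {{j !≢0}})
... | inj₂ z≤j = begin
  z ^ j                       ≡⟨ cong (z ^_) (sym (m+[n∸m]≡n z≤j)) ⟩
  z ^ (z + i)                 ≡⟨ trans (^-distribˡ-+-* z z i) (*-comm (z ^ z) (z ^ i)) ⟩
  z ^ i * z ^ z               ≤⟨ *-monoˡ-≤ (z ^ z) (z^i≤[z+i]! i) ⟩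
  (z + i) ! * z ^ z           ≡⟨ cong (λ x → x ! * z ^ z) (m+[n∸m]≡n z≤j) ⟩
  j ! * z ^ z ∎
  where
  open ≤-Reasoning
  i = j ∸ z
  z^i≤[z+i]! : ∀ i → z ^ i ≤ (z + i) !
  z^i≤[z+i]! zero = 1≤n! (z + 0)
  z^i≤[z+i]! (suc i) rewrite +-suc z i = *-mono-≤ (≤-trans (m≤m+n z i) (n≤1+n _)) (z^i≤[z+i]! i)

-- Lowering either `a` or `b` by one still leaves both at least k - 1, so both terms of Pascal's
-- rule are at least 2^(k - 1).
2^k≤[a+b]Ca : ∀ k a b → k ≤ a → k ≤ b → 2 ^ k ≤ (a + b) C a
2^k≤[a+b]Ca zero a b _ _ = go a b
  where
  go : ∀ a b → 1 ≤ (a + b) C a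
  go zero b = ≤-reflexive (sym (nC0≡1 b))
  go (suc a) b = ≤-trans (go a b) (≤-trans (m≤m+n _ _) (≤-reflexive (nCk+nC[k+1]≡[n+1]C[k+1] (a + b) a)))
2^k≤[a+b]Ca (suc k) (suc a) (suc b) (s≤s k≤a) (s≤s k≤b) = begin
  2 ^ k + (2 ^ k + 0)                         ≡⟨ cong (2 ^ k +_) (+-identityʳ _) ⟩
  2 ^ k + 2 ^ k                               ≤⟨ +-mono-≤ (2^k≤[a+b]Ca k a (suc b) k≤a (m≤n⇒m≤1+n k≤b))
                                                          (2^k≤[a+b]Ca k (suc a) b (m≤n⇒m≤1+n k≤a) k≤b) ⟩
  ((a + suc b) C a) + ((suc a + b) C suc a)   ≡⟨ cong (λ x → ((a + suc b) C a) + (x C suc a)) (sym (+-suc a b)) ⟩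
  ((a + suc b) C a) + ((a + suc b) C suc a)   ≡⟨ nCk+nC[k+1]≡[n+1]C[k+1] (a + suc b) a ⟩
  (suc a + suc b) C suc a ∎
  where open ≤-Reasoning

^-distribʳ-* : ∀ k a b → (a * b) ^ k ≡ a ^ k * b ^ k
^-distribʳ-* zero a b = refl
^-distribʳ-* (suc k) a b = trans (cong (a * b *_) (^-distribʳ-* k a b)) (lem a b (a ^ k) (b ^ k))
  where
  lem : ∀ a b x y → a * b * (x * y) ≡ a * x * (b * y)
  lem = solve-∀

typed-count : ℕ → ℕ → ℕ → ℕ → ℕ
typed-count n t j r = (n C t) * (((r + j) C j) * ((r C j) * (((r ∸ j) C j) * (r ! * (r ∸ j) !))))

-- Relative to C(n, m) r!², with m = t + j, the count is at most C(m, j) C(r, j) / j!. One-term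
-- binomial estimates bound the two coefficients by Y^(2j) (1 + 1/Y)^n, and (Y²)^j / j! is at most a
-- constant depending on `Y` alone. So the growth rate is as close to 1 as desired.
typed-count-bound : ∀ Y .{{_ : NonZero Y}} t j r → let n = t + j + r in
  typed-count (t + j + r) t j r * Y ^ n ≤ (n C (t + j)) * (r ! * r !) * ((Y * Y) ^ (Y * Y) * (1 + Y) ^ n)
typed-count-bound Y t j r with j ≤? r
-- The factor `r C j` vanishes, so the truncation in `r ∸ j` has no effect.
... | no j≰r = ≤-trans (≤-reflexive (cong (_* Y ^ n) zero-count)) z≤n
  where
  n = t + j + r
  zero-count : typed-count (t + j + r) t j r ≡ 0
  zero-count rewrite k>n⇒nCk≡0 (≰⇒> j≰r) | *-zeroʳ ((r + j) C j) = *-zeroʳ (n C t)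
... | yes j≤r = *-cancelʳ-≤ _ _ (j !) {{j !≢0}} (begin
  typed-count (t + j + r) t j r * Y ^ n * j !
    ≡⟨ cong (λ x → typed-count (t + j + r) t j r * x * j !) (^-distribˡ-+-* Y m r) ⟩
  typed-count (t + j + r) t j r * (Y ^ m * Y ^ r) * j !
    ≡⟨ lem₁ (n C t) ((r + j) C j) (r C j) ((r ∸ j) C j) (r !) ((r ∸ j) !) (Y ^ m) (Y ^ r) (j !) ⟩
  ((n C t) * ((r + j) C j)) * r ! * (((r ∸ j) C j) * (r ∸ j) ! * j !) * Y ^ m * ((r C j) * Y ^ r)
    ≡⟨ cong (λ x → x * r ! * (((r ∸ j) C j) * (r ∸ j) ! * j !) * Y ^ m * ((r C j) * Y ^ r)) (binomial-trinomial t j r) ⟩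
  ((n C m) * (m C j)) * r ! * (((r ∸ j) C j) * (r ∸ j) ! * j !) * Y ^ m * ((r C j) * Y ^ r)
    ≡⟨ lem₂ (n C m) (m C j) (r !) (((r ∸ j) C j) * (r ∸ j) ! * j !) (Y ^ m) ((r C j) * Y ^ r) ⟩
  (n C m) * (r ! * (((r ∸ j) C j) * (r ∸ j) ! * j !)) * (((m C j) * Y ^ m) * ((r C j) * Y ^ r))
    ≤⟨ *-mono-≤ (*-monoʳ-≤ (n C m) (*-monoʳ-≤ (r !)
         (≤-trans (wCj*w!*j!≤[j+w]! j (r ∸ j)) (≤-reflexive (cong _! (m+[n∸m]≡n j≤r))))))
         (*-mono-≤ (mCj*Y^m≤Y^j*[1+Y]^m Y m j) (mCj*Y^m≤Y^j*[1+Y]^m Y r j)) ⟩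
  (n C m) * (r ! * r !) * ((Y ^ j * (1 + Y) ^ m) * (Y ^ j * (1 + Y) ^ r))
    ≡⟨ cong ((n C m) * (r ! * r !) *_) (lem₃ (Y ^ j) ((1 + Y) ^ m) ((1 + Y) ^ r)) ⟩
  (n C m) * (r ! * r !) * (Y ^ j * Y ^ j * ((1 + Y) ^ m * (1 + Y) ^ r))
    ≡⟨ cong₂ (λ x y → (n C m) * (r ! * r !) * (x * y)) (sym (^-distribʳ-* j Y Y)) (sym (^-distribˡ-+-* (1 + Y) m r)) ⟩
  (n C m) * (r ! * r !) * ((Y * Y) ^ j * (1 + Y) ^ n)
    ≤⟨ *-monoʳ-≤ ((n C m) * (r ! * r !)) (*-monoˡ-≤ ((1 + Y) ^ n) (z^j≤j!*z^z (Y * Y) {{m*n≢0 Y Y}} j)) ⟩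
  (n C m) * (r ! * r !) * (j ! * G * (1 + Y) ^ n)
    ≡⟨ lem₄ ((n C m) * (r ! * r !)) (j !) G ((1 + Y) ^ n) ⟩
  (n C m) * (r ! * r !) * (G * (1 + Y) ^ n) * j ! ∎)
  where
  open ≤-Reasoning
  m = t + j
  n = t + j + r
  G = (Y * Y) ^ (Y * Y)
  lem₁ : ∀ a b c d e f y z i → a * (b * (c * (d * (e * f)))) * (y * z) * i ≡ (a * b) * e * (d * f * i) * y * (c * z)
  lem₁ = solve-∀
  lem₂ : ∀ a b e f y z → (a * b) * e * f * y * z ≡ a * (e * f) * ((b * y) * z)
  lem₂ = solve-∀
  lem₃ : ∀ a b c → (a * b) * (a * c) ≡ a * a * (b * c)
  lem₃ = solve-∀
  lem₄ : ∀ a i g k → a * (i * g * k) ≡ a * (g * k) * i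
  lem₄ = solve-∀

-- Enumerating permutations and derangements

-- v, extended by a new fixed point, composed with the transposition of that point and i.
extend : ∀ {k} → Word k → Fin (suc k) → Word (suc k)
extend v zero = zero ∷ Vec.map suc v
extend v (suc i) = suc (lookup v i) ∷ (Vec.map suc v [ i ]≔ zero)

module _ {k} (v : Word k) where

  lookup-extend-0 : ∀ j → lookup (extend v zero) (suc j) ≡ suc (lookup v j)
  lookup-extend-0 j = lookup-map j suc v

  lookup-extend-≡ : ∀ i → lookup (extend v (suc i)) (suc i) ≡ zero
  lookup-extend-≡ i = lookup∘update i (Vec.map suc v) zero

  lookup-extend-≢ : ∀ {i j} → j ≢ i → lookup (extend v (suc i)) (suc j) ≡ suc (lookup v j)
  lookup-extend-≢ {i} {j} ne = trans (lookup∘update′ ne (Vec.map suc v) zero) (lookup-map j suc v)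

  extend-IsPerm : IsPerm v → ∀ i → IsPerm (extend v i)
  extend-IsPerm inj i zero zero eq = refl
  extend-IsPerm inj zero zero (suc b) eq with () ← trans eq (lookup-extend-0 b)
  extend-IsPerm inj zero (suc a) zero eq with () ← trans (sym eq) (lookup-extend-0 a)
  extend-IsPerm inj zero (suc a) (suc b) eq =
    cong suc (inj a b (Fin.suc-injective (trans (sym (lookup-extend-0 a)) (trans eq (lookup-extend-0 b)))))
  extend-IsPerm inj (suc i) zero (suc b) eq with b Fin.≟ i
  ... | yes refl with () ← trans eq (lookup-extend-≡ i)
  ... | no ne = contradiction (sym (inj i b (Fin.suc-injective (trans eq (lookup-extend-≢ ne))))) ne
  extend-IsPerm inj (suc i) (suc a) zero eq with a Fin.≟ i
  ... | yes refl with () ← trans (sym eq) (lookup-extend-≡ i)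
  ... | no ne = contradiction (inj a i (Fin.suc-injective (trans (sym (lookup-extend-≢ ne)) eq))) ne
  extend-IsPerm inj (suc i) (suc a) (suc b) eq with a Fin.≟ i | b Fin.≟ i
  ... | yes refl | yes refl = refl
  ... | yes refl | no ne with () ← trans (sym (lookup-extend-≡ i)) (trans eq (lookup-extend-≢ ne))
  ... | no ne | yes refl with () ← trans (sym (lookup-extend-≢ ne)) (trans eq (lookup-extend-≡ i))
  ... | no ne | no ne′ =
    cong suc (inj a b (Fin.suc-injective (trans (sym (lookup-extend-≢ ne)) (trans eq (lookup-extend-≢ ne′)))))

extend-injective : ∀ {k} {v w : Word k} {i j} → extend v i ≡ extend w j → v ≡ w × i ≡ j
extend-injective {v = v} {w} {zero} {zero} eq =
  lookup-ext (λ l → Fin.suc-injective (trans (sym (lookup-extend-0 v l))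
    (trans (cong (λ x → lookup x (suc l)) eq) (lookup-extend-0 w l)))) , refl
extend-injective {i = zero} {suc j} eq with () ← cong (λ x → lookup x zero) eq
extend-injective {i = suc i} {zero} eq with () ← cong (λ x → lookup x zero) eq
extend-injective {v = v} {w} {suc i} {suc j} eq with i Fin.≟ j
... | no ne with () ← trans (sym (lookup-extend-≡ v i)) (trans (cong (λ x → lookup x (suc i)) eq) (lookup-extend-≢ w ne))
... | yes refl = lookup-ext same , refl
  where
  same : ∀ l → lookup v l ≡ lookup w l
  same l with l Fin.≟ i
  ... | yes refl = Fin.suc-injective (cong (λ x → lookup x zero) eq)
  ... | no ne = Fin.suc-injective (trans (sym (lookup-extend-≢ v ne))
                  (trans (cong (λ x → lookup x (suc l)) eq) (lookup-extend-≢ w ne)))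

length-cartesianProductWith : ∀ {C : Set} (f : A → B → C) xs ys →
                              length (cartesianProductWith f xs ys) ≡ length xs * length ys
length-cartesianProductWith f [] ys = refl
length-cartesianProductWith f (x ∷ xs) ys = trans (length-++ (map (f x) ys))
  (cong₂ _+_ (length-map (f x) ys) (length-cartesianProductWith f xs ys))

All-cartesianProductWith : ∀ {C : Set} {P : A → Set} {Q : C → Set} (f : A → B → C) →
                           (∀ {x} → P x → ∀ y → Q (f x y)) → ∀ {xs} ys → All P xs → All Q (cartesianProductWith f xs ys)
All-cartesianProductWith f h ys [] = []
All-cartesianProductWith f h ys (p ∷ ps) =
  All.++⁺ (All.map⁺ (All.universal (h p) ys)) (All-cartesianProductWith f h ys ps)

permutations : ∀ n → List (Word n)
permutations zero = [] ∷ []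
permutations (suc n) = cartesianProductWith extend (permutations n) (allFin (suc n))

permutations-IsPerm : ∀ n → All IsPerm (permutations n)
permutations-IsPerm zero = (λ ()) ∷ []
permutations-IsPerm (suc n) =
  All-cartesianProductWith extend (extend-IsPerm _) (allFin (suc n)) (permutations-IsPerm n)

permutations-Unique : ∀ n → Unique (permutations n)
permutations-Unique zero = [] ∷ []
permutations-Unique (suc n) =
  Unique.cartesianProductWith⁺ extend extend-injective (permutations-Unique n) (Unique.allFin⁺ (suc n))

length-permutations : ∀ n → length (permutations n) ≡ n !
length-permutations zero = refl
length-permutations (suc n) = begin
  length (permutations (suc n))                      ≡⟨ length-cartesianProductWith extend (permutations n) (allFin (suc n)) ⟩
  length (permutations n) * length (allFin (suc n))  ≡⟨ cong₂ _*_ (length-permutations n) (length-tabulate {n = suc n} id) ⟩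
  n ! * suc n                                        ≡⟨ *-comm (n !) (suc n) ⟩
  suc n ! ∎
  where open ≡-Reasoning

add-fixed : ∀ {k} → Fin (suc k) → Word k → Word (suc k)
add-fixed i h = insertAt (Vec.map (punchIn i) h) i i

module _ {k} (i : Fin (suc k)) (h : Word k) where

  lookup-add-fixed : lookup (add-fixed i h) i ≡ i
  lookup-add-fixed = insertAt-lookup (Vec.map (punchIn i) h) i i

  lookup-add-fixed-punchIn : ∀ j → lookup (add-fixed i h) (punchIn i j) ≡ punchIn i (lookup h j)
  lookup-add-fixed-punchIn j = trans (insertAt-punchIn (Vec.map (punchIn i) h) i i j) (lookup-map j (punchIn i) h)

data PunchView {k} (i : Fin (suc k)) : Fin (suc k) → Set where
  pivot : PunchView i i
  other : ∀ j → PunchView i (punchIn i j)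

punchView : ∀ {k} (i a : Fin (suc k)) → PunchView i a
punchView i a with i Fin.≟ a
... | yes refl = pivot
... | no i≢a = subst (PunchView i) (punchIn-punchOut i≢a) (other (punchOut i≢a))

add-fixed-IsPerm : ∀ {k} i {h : Word k} → IsPerm h → IsPerm (add-fixed i h)
add-fixed-IsPerm i {h} inj a b eq with punchView i a | punchView i b
... | pivot | pivot = refl
... | pivot | other c = contradiction
  (trans (sym (lookup-add-fixed-punchIn i h c)) (trans (sym eq) (lookup-add-fixed i h))) (punchInᵢ≢i i (lookup h c))
... | other c | pivot = contradiction
  (trans (sym (lookup-add-fixed-punchIn i h c)) (trans eq (lookup-add-fixed i h))) (punchInᵢ≢i i (lookup h c))
... | other c | other c′ = cong (punchIn i) (inj c c′ (punchIn-injective i _ _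
  (trans (sym (lookup-add-fixed-punchIn i h c)) (trans eq (lookup-add-fixed-punchIn i h c′)))))

add-fixed-injective : ∀ {k} i {h h′ : Word k} → add-fixed i h ≡ add-fixed i h′ → h ≡ h′
add-fixed-injective i {h} {h′} eq = lookup-ext (λ j → punchIn-injective i _ _
  (trans (sym (lookup-add-fixed-punchIn i h j))
    (trans (cong (λ x → lookup x (punchIn i j)) eq) (lookup-add-fixed-punchIn i h′ j))))

IsDerangement : ∀ {k} → Word k → Set
IsDerangement v = IsPerm v × ∀ i → lookup v i ≢ i

-- The transposition of `i` with the new point destroys a fixed point at `i`, so `v` may have one
-- there and nowhere else. This serves both branches of the recurrence: `v` without fixed points,
-- and `v` with exactly one.
extend-IsDerangement : ∀ {k} {v : Word k} i → IsPerm v → (∀ j → lookup v j ≡ j → j ≡ i) → IsDerangement (extend v (suc i))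
extend-IsDerangement {v = v} i inj fixed = extend-IsPerm v inj (suc i) , no-fixed
  where
  no-fixed : ∀ j → lookup (extend v (suc i)) j ≢ j
  no-fixed zero ()
  no-fixed (suc j) eq with j Fin.≟ i
  ... | yes refl with () ← trans (sym (lookup-extend-≡ v i)) eq
  ... | no ne = ne (fixed j (Fin.suc-injective (trans (sym (lookup-extend-≢ v ne)) eq)))

add-fixed-fixed : ∀ {k} i {h : Word k} → IsDerangement h → ∀ j → lookup (add-fixed i h) j ≡ j → j ≡ i
add-fixed-fixed i {h} (_ , no-fixed) a eq with punchView i a
... | pivot = refl
... | other c = contradiction (punchIn-injective i _ _ (trans (sym (lookup-add-fixed-punchIn i h c)) eq)) (no-fixed c)

-- The derangements of k + 2 points, according to whether the preimage of 0 lies in a cycle of length at least 3 or 2.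
extend₁ : ∀ {k} → Word (suc k) → Fin (suc k) → Word (suc (suc k))
extend₁ f i = extend f (suc i)

extend₂ : ∀ {k} → Word k → Fin (suc k) → Word (suc (suc k))
extend₂ h i = extend (add-fixed i h) (suc i)

derangements : ∀ k → List (Word k)
derangements 0 = [] ∷ []
derangements 1 = []
derangements (suc (suc k)) = cartesianProductWith extend₁ (derangements (suc k)) (allFin (suc k))
                          ++ cartesianProductWith extend₂ (derangements k) (allFin (suc k))

derangements-IsDerangement : ∀ k → All IsDerangement (derangements k)
derangements-IsDerangement 0 = ((λ ()) , (λ ())) ∷ []
derangements-IsDerangement 1 = []
derangements-IsDerangement (suc (suc k)) = All.++⁺
  (All-cartesianProductWith extend₁ (λ (inj , nf) i → extend-IsDerangement i inj (λ j eq → contradiction eq (nf j)))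
    (allFin (suc k)) (derangements-IsDerangement (suc k)))
  (All-cartesianProductWith extend₂ (λ d i → extend-IsDerangement i (add-fixed-IsPerm i (proj₁ d)) (add-fixed-fixed i d))
    (allFin (suc k)) (derangements-IsDerangement k))

derangements-Unique : ∀ k → Unique (derangements k)
derangements-Unique 0 = [] ∷ []
derangements-Unique 1 = []
derangements-Unique (suc (suc k)) = Unique.++⁺
  (Unique.cartesianProductWith⁺ extend₁ extend₁-injective (derangements-Unique (suc k)) (Unique.allFin⁺ (suc k)))
  (Unique.cartesianProductWith⁺ extend₂ extend₂-injective (derangements-Unique k) (Unique.allFin⁺ (suc k)))
  (λ { (∈₁ , ∈₂) → disjoint (∈-cartesianProductWith⁻ extend₁ (derangements (suc k)) (allFin (suc k)) ∈₁)
                            (∈-cartesianProductWith⁻ extend₂ (derangements k) (allFin (suc k)) ∈₂) })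
  where
  extend₁-injective : ∀ {f g : Word (suc k)} {i j} → extend₁ f i ≡ extend₁ g j → f ≡ g × i ≡ j
  extend₁-injective {f} {g} {i} {j} eq with f≡g , refl ← extend-injective {v = f} {g} {suc i} {suc j} eq = f≡g , refl
  extend₂-injective : ∀ {f g : Word k} {i j} → extend₂ f i ≡ extend₂ g j → f ≡ g × i ≡ j
  extend₂-injective {f} {g} {i} {j} eq
    with f≡g , refl ← extend-injective {v = add-fixed i f} {add-fixed j g} {suc i} {suc j} eq = add-fixed-injective i f≡g , refl
  disjoint : ∀ {x} → (∃ λ f → ∃ λ i → f ∈ derangements (suc k) × i ∈ allFin (suc k) × x ≡ extend₁ f i) →
             (∃ λ h → ∃ λ i → h ∈ derangements k × i ∈ allFin (suc k) × x ≡ extend₂ h i) → ⊥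
  disjoint (f , i , f∈ , _ , refl) (h , i′ , _ , _ , eq) 
    with refl , refl ← extend-injective {v = f} {add-fixed i′ h} {suc i} {suc i′} eq =
    proj₂ (All.lookup (derangements-IsDerangement (suc k)) f∈) i (lookup-add-fixed i h)

length-derangements : ∀ k → length (derangements (2 + k)) ≡ suc k * (length (derangements (suc k)) + length (derangements k))
length-derangements k = begin
  length (derangements (2 + k))   ≡⟨ length-++ (cartesianProductWith extend₁ (derangements (suc k)) (allFin (suc k))) ⟩
  _                               ≡⟨ cong₂ _+_ (length-cartesianProductWith extend₁ (derangements (suc k)) (allFin (suc k)))
                                               (length-cartesianProductWith extend₂ (derangements k) (allFin (suc k))) ⟩
  a * length (allFin (suc k)) + b * length (allFin (suc k))
                                  ≡⟨ cong (λ l → a * l + b * l) (length-tabulate {n = suc k} id) ⟩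
  a * suc k + b * suc k           ≡⟨ trans (sym (*-distribʳ-+ (suc k) a b)) (*-comm (a + b) (suc k)) ⟩
  suc k * (a + b) ∎
  where
  open ≡-Reasoning
  a = length (derangements (suc k))
  b = length (derangements k)

-- Factorials obey the same recurrence, (k + 2)! = (k + 1) ((k + 1)! + k!), so the ratio 3
-- propagates from two consecutive values. It starts at 2 because there is no derangement of one
-- point, and 3! = 3 · 2 makes the constant sharp.
k!≤3*length-derangements : ∀ k → (2 + k) ! ≤ 3 * length (derangements (2 + k)) × (3 + k) ! ≤ 3 * length (derangements (3 + k))
k!≤3*length-derangements zero = s≤s (s≤s z≤n) , ≤-refl
k!≤3*length-derangements (suc k) with h₂ , h₃ ← k!≤3*length-derangements k = h₃ , (begin
  (4 + k) !                        ≡⟨ lem k ((2 + k) !) ⟩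
  (3 + k) * ((3 + k) ! + (2 + k) !) ≤⟨ *-monoʳ-≤ (3 + k) (+-mono-≤ h₃ h₂) ⟩
  (3 + k) * (3 * a + 3 * b)        ≡⟨ lem₂ (3 + k) a b ⟩
  3 * ((3 + k) * (a + b))          ≡⟨ cong (3 *_) (sym (length-derangements (2 + k))) ⟩
  3 * length (derangements (4 + k)) ∎)
  where
  open ≤-Reasoning
  a = length (derangements (3 + k))
  b = length (derangements (2 + k))
  lem : ∀ k f → (4 + k) * ((3 + k) * f) ≡ (3 + k) * ((3 + k) * f + f)
  lem = solve-∀
  lem₂ : ∀ k a b → k * (3 * a + 3 * b) ≡ 3 * (k * (a + b))
  lem₂ = solve-∀

Bounded-∈ : ∀ (ys : List A) → Bounded (_∈ ys) (length ys)
Bounded-∈ ys = Bounded-mono id (≤-reflexive (*-identityʳ (length ys)))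
  (Bounded-⋃ {R = λ y x → x ≡ y} ys (λ _ → single))
  where
  single : ∀ {y} → Bounded (_≡ y) 1
  single [] _ _ = z≤n
  single (_ ∷ []) _ _ = ≤-refl
  single (_ ∷ _ ∷ _) ((ne ∷ _) ∷ _) (refl ∷ refl ∷ _) = contradiction refl ne

∈-allVecs : ∀ {m k} (v : Vec (Fin m) k) → v ∈ allVecs m k
∈-allVecs [] = here refl
∈-allVecs (i ∷ v) = ∈-concatMap⁺ _ (lose (∈-allFin i) (∈-map⁺ (i ∷_) (∈-allVecs v)))

allᵇ⁺ : ∀ {p : A → Bool} → (∀ x → T (p x)) → ∀ xs → T (allᵇ p xs)
allᵇ⁺ h [] = tt
allᵇ⁺ h (x ∷ xs) = Equivalence.from T-∧ (h x , allᵇ⁺ h xs)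

T-not-⌊⌋ : ∀ {P : Set} (d : Dec P) → ¬ P → T (not ⌊ d ⌋)
T-not-⌊⌋ (yes p) ¬p = ¬p p
T-not-⌊⌋ (no _) _ = tt

IsDerangement⇒isDerangement : ∀ {k} {v : Word k} → IsDerangement v → T (isDerangement v)
IsDerangement⇒isDerangement {k} {v} (inj , nf) = Equivalence.from T-∧
  ( allᵇ⁺ (λ i → T-not-⌊⌋ (lookup v i Fin.≟ i) (nf i)) (allFin k)
  , allᵇ⁺ (λ i → allᵇ⁺ (distinct i) (allFin k)) (allFin k))
  where
  distinct : ∀ i j → T (⌊ i Fin.≟ j ⌋ ∨ not ⌊ lookup v i Fin.≟ lookup v j ⌋)
  distinct i j with i Fin.≟ j
  ... | yes _ = tt
  ... | no i≢j = T-not-⌊⌋ (lookup v i Fin.≟ lookup v j) (i≢j ∘ inj i j)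

-- Only a lower bound for `D` is wanted, so it is enough that the constructed derangements are
-- distinct and pass the test `isDerangement`.
k!≤3*D : ∀ k → (2 + k) ! ≤ 3 * D (2 + k)
k!≤3*D k = ≤-trans (proj₁ (k!≤3*length-derangements k)) (*-monoʳ-≤ 3
  (Bounded-∈ (filterᵇ isDerangement (allVecs (2 + k) (2 + k))) (derangements (2 + k)) (derangements-Unique (2 + k))
    (All.map (λ {v} d → ∈-filter⁺ (T? ∘ isDerangement) (∈-allVecs v) (IsDerangement⇒isDerangement {v = v} d)) (derangements-IsDerangement (2 + k)))))

-- The code of a large independent set

∑-filter : ∀ {R : A → B → Set} (R? : ∀ x y → Dec (R x y)) xs ys →
           ∑ xs (λ x → length (filter (R? x) ys)) ≡ length (filter (λ (x , y) → R? x y) (cartesianProduct xs ys))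
∑-filter R? [] ys = refl
∑-filter R? (x ∷ xs) ys = sym (begin
  length (filter P? (map (x ,_) ys ++ cartesianProduct xs ys))             ≡⟨ cong length (filter-++ P? (map (x ,_) ys) _) ⟩
  length (filter P? (map (x ,_) ys) ++ filter P? (cartesianProduct xs ys)) ≡⟨ length-++ (filter P? (map (x ,_) ys)) ⟩
  length (filter P? (map (x ,_) ys)) + length (filter P? (cartesianProduct xs ys))
    ≡⟨ cong₂ _+_ (row ys) (sym (∑-filter R? xs ys)) ⟩
  length (filter (R? x) ys) + ∑ xs (λ x → length (filter (R? x) ys)) ∎)
  where
  open ≡-Reasoning
  P? = λ p → R? (proj₁ p) (proj₂ p)
  row : ∀ ys → length (filter P? (map (x ,_) ys)) ≡ length (filter (R? x) ys)
  row [] = refl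
  row (y ∷ ys) with R? x y
  ... | yes _ = cong suc (row ys)
  ... | no _ = row ys

agreement-sym : ∀ {n} (σ τ : Word n) → agreement σ τ ≡ agreement τ σ
agreement-sym {n} σ τ = go (allFin n)
  where
  go : ∀ is → count (agree? σ τ) is ≡ count (agree? τ σ) is
  go [] = refl
  go (i ∷ is) with agree? σ τ i | agree? τ σ i
  ... | yes _ | yes _ = cong suc (go is)
  ... | no _ | no _ = go is
  ... | yes e | no ne = contradiction (sym e) ne
  ... | no ne | yes e = contradiction (sym e) ne

toPermutation : ∀ {n} (σ : Word n) → IsPerm σ → Permutation′ n
toPermutation σ inj = permutation (lookup σ) (proj₁ ∘ surj) (proj₂ ∘ surj) (λ i → inj _ _ (proj₂ (surj (lookup σ i))))
  where surj = injective⇒surjective (lookup σ) inj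

hamming-agreement : ∀ {n} (σ τ : Word n) (p : IsPerm σ) (q : IsPerm τ) →
                    n ≡ hamming (toPermutation σ p) (toPermutation τ q) + agreement σ τ
hamming-agreement {n} σ τ p q = trans (sym (length-tabulate id))
  (trans (↭-length (filter-split-↭ (agree? σ τ) (allFin n))) (length-++ (filter (∁? (agree? σ τ)) (allFin n))))

-- Fewer than `m` agreements among m + r positions leave at least r + 1 disagreements, which also
-- makes the two permutations distinct.
toCode : ∀ {n} m r → n ≡ m + r → ∀ {I : List (Word n)} → All IsPerm I → AllPairs (λ σ τ → ¬ m ≤ agreement σ τ) I →
         Σ (List (Permutation′ n)) λ C → IsPermCode n (suc r) C × length C ≡ length I
toCode {n} m r n≡ ps indep = code ps , go ps indep , length-code ps
  where
  code : ∀ {I} → All IsPerm I → List (Permutation′ n)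
  code [] = []
  code {σ ∷ _} (p ∷ ps) = toPermutation σ p ∷ code ps
  length-code : ∀ {I} (ps : All IsPerm I) → length (code ps) ≡ length I
  length-code [] = refl
  length-code (p ∷ ps) = cong suc (length-code ps)
  far : ∀ σ τ (p : IsPerm σ) (q : IsPerm τ) → ¬ m ≤ agreement σ τ →
        suc r ≤ hamming (toPermutation σ p) (toPermutation τ q)
  far σ τ p q m≰ = +-cancelˡ-≤ m _ _ (begin
    m + suc r                                                 ≡⟨ +-suc m r ⟩
    suc (m + r)                                               ≡⟨ cong suc (trans (sym n≡) (hamming-agreement σ τ p q)) ⟩
    suc (hamming (toPermutation σ p) (toPermutation τ q) + agreement σ τ) ≡⟨ sym (+-suc _ _) ⟩
    hamming (toPermutation σ p) (toPermutation τ q) + suc (agreement σ τ) ≤⟨ +-monoʳ-≤ _ (≰⇒> m≰) ⟩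
    hamming (toPermutation σ p) (toPermutation τ q) + m       ≡⟨ +-comm _ m ⟩
    m + hamming (toPermutation σ p) (toPermutation τ q) ∎)
    where open ≤-Reasoning
  go : ∀ {I} (ps : All IsPerm I) → AllPairs (λ σ τ → ¬ m ≤ agreement σ τ) I → IsPermCode n (suc r) (code ps)
  go [] [] = []
  go {σ ∷ _} (p ∷ ps) (h ∷ hs) = row ps h ∷ go ps hs
    where
    row : ∀ {I} (ps : All IsPerm I) → All (λ τ → ¬ m ≤ agreement σ τ) I →
          All (λ ρ → 0 < hamming (toPermutation σ p) ρ × suc r ≤ hamming (toPermutation σ p) ρ) (code ps)
    row [] [] = []
    row {τ ∷ _} (q ∷ qs) (m≰ ∷ ms) = (≤-trans (s≤s z≤n) (far σ τ p q m≰) , far σ τ p q m≰) ∷ row qs ms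

module Code (m r t L K : ℕ) .{{_ : NonZero L}}
  (Δ-large : t * (1 + L * 4 ^ (1 + 8 * t)) ≤ ((m + r) C m) * r !)
  (few-typed : ∀ s j → m ≡ s + j → typed-count (m + r) s j r ≤ K)
  (few-triangles : suc m * K ≤ L * L) where

  n Δ : ℕ
  n = m + r
  Δ = (n C m) * r !

  close? : ∀ (σ τ : Word n) → Dec (m ≤ agreement σ τ)
  close? σ τ = m ≤? agreement σ τ

  close-sym : ∀ {σ τ : Word n} → m ≤ agreement σ τ → m ≤ agreement τ σ
  close-sym {σ} {τ} c = ≤-trans c (≤-reflexive (agreement-sym σ τ))

  open HardCore {Word n} (≡-dec Fin._≟_) {λ σ τ → m ≤ agreement σ τ} close? (λ {σ} {τ} → close-sym {σ} {τ})

  is-perm : ∀ {σ} → σ ∈ permutations n → IsPerm σ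
  is-perm = All.lookup (permutations-IsPerm n)

  degrees : ∀ u → u ∈ permutations n → length (filter (λ v → close? v u) (permutations n)) ≤ Δ
  degrees u _ = ball-bound m r u (filter (λ v → close? v u) (permutations n))
    (AllPairs.filter⁺ _ (permutations-Unique n))
    (All.zipWith (λ {v} (p , c) → p , close-sym {v} {u} c)
      (All.filter⁺ _ (permutations-IsPerm n) , All.all-filter (λ v → close? v u) (permutations n)))

  -- The parameter j of a triangle takes one of m + 1 values, and `K` bounds the triangles for each
  -- of them.
  Triangle-bound : ∀ σ → Bounded (Triangle σ m) (suc m * K)
  Triangle-bound σ = subst (λ l → Bounded (Triangle σ m) (l * K)) (length-upTo (suc m))
    (Bounded-mono (λ {z} tri → lose (∈-upTo⁺ (s≤s (m∸n≤m m (count (allAgree? σ z) (allFin n))))) (Triangle⇒Typed σ {m} {z} tri)) ≤-refl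
      (Bounded-⋃ {R = λ j → Typed σ (m ∸ j) j} (upTo (suc m)) (λ {j} j∈ →
        let m≡ = sym (m∸n+n≡m (s≤s⁻¹ (∈-upTo⁻ j∈))) in
        Bounded-mono id (few-typed (m ∸ j) j m≡) (Typed-bound σ (m ∸ j) j r (cong (_+ r) m≡)))))

  -- The degree sum counts ordered pairs of adjacent members of `F`, each of which completes `v` to
  -- a triangle. Pairs with equal entries are included because of the loops.
  edges : ∀ v → v ∈ permutations n → ∀ F → Unique F → All (_∈ permutations n) F → All (λ x → m ≤ agreement v x) F →
          ∑ F (λ x → degree x F) ≤ L * L
  edges v _ F F-unique F⊆ F-close = begin
    ∑ F (λ x → degree x F)               ≡⟨ ∑-filter close? F F ⟩
    length (filter P? (cartesianProduct F F))
      ≤⟨ Triangle-bound v (filter P? (cartesianProduct F F)) (AllPairs.filter⁺ P? (Unique.cartesianProduct⁺ F-unique F-unique))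
           (All.tabulate triangle) ⟩
    suc m * K                            ≤⟨ few-triangles ⟩
    L * L ∎
    where
    open ≤-Reasoning
    P? = λ p → close? (proj₁ p) (proj₂ p)
    triangle : ∀ {z} → z ∈ filter P? (cartesianProduct F F) → Triangle v m z
    triangle {x , y} z∈ with z∈F×F , c ← ∈-filter⁻ P? {xs = cartesianProduct F F} z∈
                        with x∈ , y∈ ← ∈-cartesianProduct⁻ F F z∈F×F =
      (is-perm (All.lookup F⊆ x∈) , All.lookup F-close x∈) , (is-perm (All.lookup F⊆ y∈) , All.lookup F-close y∈) , c

  independent-set : ∃ λ I → I ⊆ permutations n × Indep I × t * length (permutations n) ≤ 2 * Δ * length I
  independent-set = Local.Bound.Averaging.large-independent-set L t Δ Δ-large
    (permutations n) (permutations-Unique n) degrees edges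

  code-of : (∃ λ I → I ⊆ permutations n × Indep I × t * length (permutations n) ≤ 2 * Δ * length I) →
            Σ (List (Permutation′ n)) λ C → IsPermCode n (suc r) C × t * n ! ≤ 2 * Δ * length C
  code-of (I , I⊆ , indep , large) = proj₁ code , proj₁ (proj₂ code) ,
    subst₂ (λ a b → t * a ≤ 2 * Δ * b) (length-permutations n) (sym (proj₂ (proj₂ code))) large
    where code = toCode m r refl (All-resp-⊆ I⊆ (permutations-IsPerm n)) indep

  large-code : Σ (List (Permutation′ n)) λ C → IsPermCode n (suc r) C × t * n ! ≤ 2 * Δ * length C
  large-code = code-of independent-set

-- Choice of parameters

-- The quotient is the largest L with `L * W ≤ Δ`. Since `W ≤ Δ`, rounding down loses less than a
-- factor 2, which is the origin of the 4 in the hypothesis.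
approximate-root : ∀ W Δ E .{{_ : NonZero W}} → W ≤ Δ → 4 * (W * W) * E ≤ Δ * Δ →
                   1 ≤ Δ / W × (Δ / W) * W ≤ Δ × E ≤ (Δ / W) * (Δ / W)
approximate-root W Δ E W≤Δ h = 1≤L , m/n*n≤m Δ W , *-cancelˡ-≤ (4 * (W * W)) {{m*n≢0 4 (W * W) {{_}} {{m*n≢0 W W}}}} (begin
  4 * (W * W) * E             ≤⟨ h ⟩
  Δ * Δ                       ≤⟨ *-mono-≤ Δ≤2LW Δ≤2LW ⟩
  (L * W + L * W) * (L * W + L * W) ≡⟨ lem L W ⟩
  4 * (W * W) * (L * L) ∎)
  where
  open ≤-Reasoning
  L = Δ / W
  1≤L : 1 ≤ L
  1≤L = m≥n⇒m/n>0 W≤Δ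
  Δ≤2LW : Δ ≤ L * W + L * W
  Δ≤2LW = begin
    Δ                ≡⟨ m≡m%n+[m/n]*n Δ W ⟩
    Δ % W + L * W    ≤⟨ +-monoˡ-≤ (L * W) (<⇒≤ (m%n<n Δ W)) ⟩
    W + L * W        ≤⟨ +-monoˡ-≤ (L * W) (m≤n*m W L {{>-nonZero 1≤L}}) ⟩
    L * W + L * W ∎
  lem : ∀ l w → (l * w + l * w) * (l * w + l * w) ≡ 4 * (w * w) * (l * l)
  lem = solve-∀

t<2^t : ∀ t → t < 2 ^ t
t<2^t zero = s≤s z≤n
t<2^t (suc t) = begin-strict
  suc t               <⟨ s≤s (t<2^t t) ⟩
  suc (2 ^ t)         ≤⟨ +-monoˡ-≤ (2 ^ t) (m^n>0 2 t) ⟩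
  2 ^ t + 2 ^ t       ≡⟨ cong (2 ^ t +_) (sym (+-identityʳ _)) ⟩
  2 ^ suc t ∎
  where open ≤-Reasoning

4^[kt]≡[2^t]^[2k] : ∀ k t → 4 ^ (k * t) ≡ (2 ^ t) ^ (2 * k)
4^[kt]≡[2^t]^[2k] k t = begin
  4 ^ (k * t)       ≡⟨ ^-*-assoc 2 2 (k * t) ⟩
  2 ^ (2 * (k * t)) ≡⟨ cong (2 ^_) (lem k t) ⟩
  2 ^ (t * (2 * k)) ≡⟨ sym (^-*-assoc 2 t (2 * k)) ⟩
  (2 ^ t) ^ (2 * k) ∎
  where
  open ≡-Reasoning
  lem : ∀ k t → 2 * (k * t) ≡ t * (2 * k)
  lem = solve-∀

-- In powers of a = 2^t, the factor W² brings a^32 through 4^(8t), the triangle count another a^32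
-- through 4^(16t), and the remaining polynomial factors at most a^4 once t reaches the threshold;
-- together a^68. The constant is 65536 = 4 · (2 · 4)² · 256.
budget : ∀ t q G c m r →
         let W = 2 * t * 4 ^ (1 + 8 * t); threshold = 65536 * (q * G * c) in
         threshold ≤ t → 256 * t ≤ suc r → suc m ≤ 256 * suc t * q →
         4 * (W * W) * (suc m * (G * (c * 4 ^ (16 * t)))) ≤ 2 ^ r
budget t q G c m r thr≤t 256t≤ m≤ = begin
  4 * (W * W) * (suc m * (G * (c * 4 ^ (16 * t))))
    ≤⟨ *-monoʳ-≤ (4 * (W * W)) (*-monoˡ-≤ (G * (c * 4 ^ (16 * t))) m≤) ⟩
  4 * (W * W) * (256 * suc t * q * (G * (c * 4 ^ (16 * t))))
    ≡⟨ cong₂ (λ x y → 4 * (2 * t * (4 * x) * (2 * t * (4 * x))) * (256 * suc t * q * (G * (c * y))))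
         (4^[kt]≡[2^t]^[2k] 8 t) (4^[kt]≡[2^t]^[2k] 16 t) ⟩
  4 * (2 * t * (4 * x) * (2 * t * (4 * x))) * (256 * suc t * q * (G * (c * y)))
    ≡⟨ lem t (suc t) q G c x y ⟩
  threshold * (t * t * suc t) * (x * x * y)
    ≤⟨ *-monoˡ-≤ (x * x * y) (*-mono-≤ (≤-trans thr≤t t≤a) (*-mono-≤ (*-mono-≤ t≤a t≤a) (t<2^t t))) ⟩
  a * (a * a * a) * (x * x * y)   ≡⟨ cong (λ z → a * (a * a * a) * (z * y)) (sym (^-distribˡ-+-* a 16 16)) ⟩
  a * (a * a * a) * (y * y)       ≡⟨ cong (a * (a * a * a) *_) (sym (^-distribˡ-+-* a 32 32)) ⟩
  a * (a * a * a) * a ^ 64        ≡⟨ lem₂ a (a ^ 64) ⟩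
  a ^ 4 * a ^ 64                  ≡⟨ sym (^-distribˡ-+-* a 4 64) ⟩
  a ^ 68                          ≡⟨ ^-*-assoc 2 t 68 ⟩
  2 ^ (t * 68)                    ≤⟨ ^-monoʳ-≤ 2 68t≤r ⟩
  2 ^ r ∎
  where
  open ≤-Reasoning
  W = 2 * t * 4 ^ (1 + 8 * t)
  threshold = 65536 * (q * G * c)
  a = 2 ^ t
  x = a ^ 16
  y = a ^ 32
  t≤a : t ≤ a
  t≤a = <⇒≤ (t<2^t t)
  68t≤r : t * 68 ≤ r
  68t≤r = go t 256t≤
    where
    go : ∀ t → 256 * t ≤ suc r → t * 68 ≤ r
    go zero _ = z≤n
    go (suc t) h = s≤s⁻¹ (≤-trans (s≤s (≤-reflexive (*-comm (suc t) 68))) (≤-trans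
      (≤-trans (m<m+n (68 * suc t) {188 * suc t} (s≤s z≤n)) (≤-reflexive (sym (*-distribʳ-+ (suc t) 68 188)))) h))
  lem : ∀ t t′ q G c x y → 4 * (2 * t * (4 * x) * (2 * t * (4 * x))) * (256 * t′ * q * (G * (c * y)))
                           ≡ 65536 * (q * G * c) * (t * t * t′) * (x * x * y)
  lem = solve-∀
  lem₂ : ∀ a z → a * (a * a * a) * z ≡ a * (a * (a * (a * 1))) * z
  lem₂ = solve-∀

module Parameters (p q : ℕ) (0<p : 0 < p) (2p<q : 2 * p < q) where

  instance
    q≢0 : NonZero q
    q≢0 = >-nonZero (≤-<-trans z≤n 2p<q)

  Y G N : ℕ
  -- With n ≤ 256 (t + 1) q = 16 (t + 1) Y, this choice gives (1 + 1/Y)^n ≤ 4^(16 (t + 1)).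
  Y = 16 * q
  G = (Y * Y) ^ (Y * Y)

  c threshold : ℕ
  -- The part of 4^(16 (t + 1)) that does not depend on t.
  c = 4 ^ 16
  threshold = 65536 * (q * G * c)

  -- As n ≤ d q, this makes d at least 256 (2 + threshold), hence t at least 2 + threshold.
  N = 256 * (2 + threshold) * q

  instance
    Y≢0 : NonZero Y
    Y≢0 = m*n≢0 16 q
    G≢0 : NonZero G
    G≢0 = m^n≢0 (Y * Y) (Y * Y) {{m*n≢0 Y Y}}

  module _ (m r : ℕ) (N≤n : N ≤ m + r) (d≡δn : suc r * q ≡ p * (m + r)) where

    n t U K W Δ : ℕ
    n = m + r
    -- A linear stand-in for log (Δ / L); the divisor 256 leaves ample room for the exponent 68 t of
    -- `budget`.
    t = suc r / 256
    U = G * (c * 4 ^ (16 * t))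
    K = (n C m) * (r ! * r !) * U
    -- Chosen so that t (1 + L s) ≤ 2 t s L = L W for s = 4^(1 + 8t) and L ≥ 1.
    W = 2 * t * 4 ^ (1 + 8 * t)
    Δ = (n C m) * r !

    n≤dq : n ≤ suc r * q
    n≤dq = ≤-trans (m≤n*m n p {{>-nonZero 0<p}}) (≤-reflexive (sym d≡δn))

    -- Here δ < 1/2 enters: it yields r ≤ m and thereby C(n, m) ≥ 2^r, the exponential factor that
    -- outweighs the triangles.
    2d≤n : 2 * suc r ≤ n
    2d≤n = *-cancelʳ-≤ (2 * suc r) n q (begin
      2 * suc r * q      ≡⟨ *-assoc 2 (suc r) q ⟩
      2 * (suc r * q)    ≡⟨ cong (2 *_) d≡δn ⟩
      2 * (p * n)        ≡⟨ sym (*-assoc 2 p n) ⟩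
      2 * p * n          ≤⟨ *-monoˡ-≤ n (<⇒≤ 2p<q) ⟩
      q * n              ≡⟨ *-comm q n ⟩
      n * q ∎)
      where open ≤-Reasoning

    r≤m : r ≤ m
    r≤m = +-cancelʳ-≤ r r m (≤-trans (+-mono-≤ (n≤1+n r) (n≤1+n r))
            (≤-trans (≤-reflexive (cong (suc r +_) (sym (+-identityʳ (suc r))))) 2d≤n))

    d<256[t+1] : suc r < suc t * 256
    d<256[t+1] = begin-strict
      suc r                      ≡⟨ m≡m%n+[m/n]*n (suc r) 256 ⟩
      suc r % 256 + t * 256      <⟨ +-monoˡ-< (t * 256) (m%n<n (suc r) 256) ⟩
      256 + t * 256 ∎
      where open ≤-Reasoning

    256t≤d : 256 * t ≤ suc r
    256t≤d = ≤-trans (≤-reflexive (*-comm 256 t)) (m/n*n≤m (suc r) 256)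

    2+threshold≤t : 2 + threshold ≤ t
    2+threshold≤t = s≤s⁻¹ (*-cancelʳ-< 256 (2 + threshold) (suc t) (≤-<-trans
      (≤-trans (≤-reflexive (*-comm (2 + threshold) 256))
        (*-cancelʳ-≤ (256 * (2 + threshold)) (suc r) q (≤-trans N≤n n≤dq)))
      d<256[t+1]))

    1≤t : 1 ≤ t
    1≤t = ≤-trans (s≤s z≤n) 2+threshold≤t

    256≤d : 256 ≤ suc r
    256≤d = ≤-trans (*-monoʳ-≤ 256 1≤t) 256t≤d

    n≤256[t+1]q : n ≤ 256 * suc t * q
    n≤256[t+1]q = ≤-trans n≤dq (*-monoˡ-≤ q (≤-trans (<⇒≤ d<256[t+1]) (≤-reflexive (*-comm (suc t) 256))))

    m+1≤n : suc m ≤ n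
    m+1≤n = m<m+n m (≤-trans (s≤s z≤n) (s≤s⁻¹ 256≤d))

    4W²[m+1]U≤nCm : 4 * (W * W) * (suc m * U) ≤ n C m
    4W²[m+1]U≤nCm = ≤-trans
      (budget t q G (c) m r (≤-trans (m≤n+m threshold 2) 2+threshold≤t) 256t≤d (≤-trans m+1≤n n≤256[t+1]q))
      (2^k≤[a+b]Ca r m r r≤m ≤-refl)

    instance
      t≢0 : NonZero t
      t≢0 = >-nonZero 1≤t
      W≢0 : NonZero W
      W≢0 = m*n≢0 (2 * t) (4 ^ (1 + 8 * t)) {{m*n≢0 2 t}} {{m^n≢0 4 (1 + 8 * t)}}
      U≢0 : NonZero U
      U≢0 = m*n≢0 G (c * 4 ^ (16 * t)) {{G≢0}} {{m*n≢0 c (4 ^ (16 * t)) {{m^n≢0 4 16}} {{m^n≢0 4 (16 * t)}}}}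

    W≤Δ : W ≤ Δ
    W≤Δ = begin
      W                                ≤⟨ m≤m*n W W ⟩
      W * W                            ≤⟨ m≤n*m (W * W) 4 ⟩
      4 * (W * W)                      ≤⟨ m≤m*n (4 * (W * W)) (suc m * U) {{m*n≢0 (suc m) U}} ⟩
      4 * (W * W) * (suc m * U)        ≤⟨ 4W²[m+1]U≤nCm ⟩
      n C m                            ≤⟨ m≤m*n (n C m) (r !) {{r !≢0}} ⟩
      Δ ∎
      where open ≤-Reasoning

    -- Of the two factors C(n, m) in Δ², one is already present in `K`; the other absorbs everything
    -- else.
    4W²E≤Δ² : 4 * (W * W) * (suc m * K) ≤ Δ * Δ
    4W²E≤Δ² = begin
      4 * (W * W) * (suc m * K)                              ≡⟨ lem (4 * (W * W)) (suc m) (n C m) (r !) U ⟩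
      (4 * (W * W) * (suc m * U)) * ((n C m) * (r ! * r !))  ≤⟨ *-monoˡ-≤ ((n C m) * (r ! * r !)) 4W²[m+1]U≤nCm ⟩
      (n C m) * ((n C m) * (r ! * r !))                      ≡⟨ lem₂ (n C m) (r !) ⟩
      Δ * Δ ∎
      where
      open ≤-Reasoning
      lem : ∀ w m c f j → w * (m * (c * (f * f) * j)) ≡ (w * (m * j)) * (c * (f * f))
      lem = solve-∀
      lem₂ : ∀ c f → c * (c * (f * f)) ≡ (c * f) * (c * f)
      lem₂ = solve-∀

    L : ℕ
    L = Δ / W

    L-bounds : 1 ≤ L × L * W ≤ Δ × suc m * K ≤ L * L
    L-bounds = approximate-root W Δ (suc m * K) W≤Δ 4W²E≤Δ²

    instance
      L≢0 : NonZero L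
      L≢0 = >-nonZero (proj₁ L-bounds)

    Δ-large : t * (1 + L * 4 ^ (1 + 8 * t)) ≤ Δ
    Δ-large = begin
      t * (1 + L * s)        ≤⟨ *-monoʳ-≤ t (+-monoˡ-≤ (L * s) (*-mono-≤ (proj₁ L-bounds) (m^n>0 4 (1 + 8 * t)))) ⟩
      t * (L * s + L * s)    ≡⟨ lem t L s ⟩
      L * W                  ≤⟨ proj₁ (proj₂ L-bounds) ⟩
      Δ ∎
      where
      open ≤-Reasoning
      s = 4 ^ (1 + 8 * t)
      lem : ∀ t l s → t * (l * s + l * s) ≡ l * (2 * t * s)
      lem = solve-∀

    [1+Y]^n≤ : (1 + Y) ^ n ≤ c * 4 ^ (16 * t) * Y ^ n
    [1+Y]^n≤ = ≤-trans ([1+L]^m≤4^s*L^m Y (16 + 16 * t) n (≤-trans n≤256[t+1]q (≤-reflexive (lem t q))))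
                       (≤-reflexive (cong (_* Y ^ n) (^-distribˡ-+-* 4 16 (16 * t))))
      where
      lem : ∀ t q → 256 * suc t * q ≡ (16 + 16 * t) * (16 * q)
      lem = solve-∀

    few-typed : ∀ s j → m ≡ s + j → typed-count n s j r ≤ K
    few-typed s j refl = *-cancelʳ-≤ (typed-count n s j r) K (Y ^ n) {{m^n≢0 Y n}} (begin
      typed-count n s j r * Y ^ n                                       ≤⟨ typed-count-bound Y s j r ⟩
      (n C m) * (r ! * r !) * (G * (1 + Y) ^ n)                         ≤⟨ *-monoʳ-≤ ((n C m) * (r ! * r !)) (*-monoʳ-≤ G [1+Y]^n≤) ⟩
      (n C m) * (r ! * r !) * (G * (c * 4 ^ (16 * t) * Y ^ n))     ≡⟨ lem ((n C m) * (r ! * r !)) G (c * 4 ^ (16 * t)) (Y ^ n) ⟩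
      K * Y ^ n ∎)
      where
      open ≤-Reasoning
      lem : ∀ a g u y → a * (g * (u * y)) ≡ a * (g * u) * y
      lem = solve-∀

    -- The last summand of `V n r`, namely C(n, r) D_r, already suffices, since r ≥ 2.
    Δ≤3V : Δ ≤ 3 * V n r
    Δ≤3V = go r refl
      where
      go : ∀ r′ → r ≡ r′ → Δ ≤ 3 * V n r
      go (suc (suc k)) refl = begin
        (n C m) * r !                ≡⟨ cong (_* r !) (trans (nCk≡nC[n∸k] (m≤m+n m r)) (cong (n C_) (m+n∸m≡n m r))) ⟩
        (n C r) * r !                ≤⟨ *-monoʳ-≤ (n C r) (k!≤3*D k) ⟩
        (n C r) * (3 * D r)          ≡⟨ lem (n C r) (D r) ⟩
        3 * ((n C r) * D r)          ≤⟨ *-monoʳ-≤ 3 (m≤n+m _ (V n (suc k))) ⟩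
        3 * V n r ∎
        where
        open ≤-Reasoning
        lem : ∀ c d → c * (3 * d) ≡ 3 * (c * d)
        lem = solve-∀
      go zero eq = contradiction (subst (λ x → 256 ≤ suc x) eq 256≤d) (λ { (s≤s ()) })
      go (suc zero) eq = contradiction (subst (λ x → 256 ≤ suc x) eq 256≤d) (λ { (s≤s (s≤s ())) })

    -- The constant is 3072 = 512 · 2 · 3: 512 from n ≤ 256 (t + 1) q ≤ 512 q t, 2 from the two
    -- parts of the credit `X`, and 3 from the derangements.
    code : Σ (List (Permutation′ n)) λ C → IsPermCode n (suc r) C × 1 * n * n ! ≤ 3072 * q * length C * V n r
    code = proj₁ found , proj₁ (proj₂ found) , (begin
        1 * n * n !                              ≡⟨ cong (_* n !) (*-identityˡ n) ⟩
        n * n !                                  ≤⟨ *-monoˡ-≤ (n !) n≤512tq ⟩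
        512 * q * t * n !                        ≡⟨ *-assoc (512 * q) t (n !) ⟩
        512 * q * (t * n !)                      ≤⟨ *-monoʳ-≤ (512 * q) (proj₂ (proj₂ found)) ⟩
        512 * q * (2 * Δ * length (proj₁ found))             ≤⟨ *-monoʳ-≤ (512 * q) (*-monoˡ-≤ (length (proj₁ found)) (*-monoʳ-≤ 2 Δ≤3V)) ⟩
        512 * q * (2 * (3 * V n r) * length (proj₁ found))   ≡⟨ lem q (V n r) (length (proj₁ found)) ⟩
        3072 * q * length (proj₁ found) * V n r ∎)
      where
      open ≤-Reasoning
      found = Code.large-code m r t L K Δ-large few-typed (proj₂ (proj₂ L-bounds))
      lem : ∀ q v l → 512 * q * (2 * (3 * v) * l) ≡ 3072 * q * l * v
      lem = solve-∀
      lem₂ : ∀ q t → 256 * (t + t) * q ≡ 512 * q * t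
      lem₂ = solve-∀
      n≤512tq : n ≤ 512 * q * t
      n≤512tq = ≤-trans n≤256[t+1]q (≤-trans (*-monoˡ-≤ q (*-monoʳ-≤ 256 (+-monoˡ-≤ t 1≤t))) (≤-reflexive (lem₂ q t)))

theorem2 : (p q : ℕ) → 0 < p → 2 * p < q →
    Σ ℕ λ a → Σ ℕ λ b → 0 < a × 0 < b × Σ ℕ λ N →
    (n d : ℕ) → N ≤ n → d * q ≡ p * n →
    Σ (List (Permutation′ n)) λ C →
    IsPermCode n d C × a * n * (n !) ≤ b * length C * V n (d ∸ 1)
theorem2 p q 0<p 2p<q = 1 , 3072 * q , s≤s z≤n , *-mono-≤ {1} {3072} {1} {q} (s≤s z≤n) (>-nonZero⁻¹ q) , N , conclusion
  where
  open Parameters p q 0<p 2p<q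

  0<N : 0 < N
  0<N = *-mono-≤ {1} {256 * (2 + threshold)} {1} {q} (s≤s z≤n) (>-nonZero⁻¹ q)

  conclusion : (n d : ℕ) → N ≤ n → d * q ≡ p * n →
               Σ (List (Permutation′ n)) λ C → IsPermCode n d C × 1 * n * (n !) ≤ 3072 * q * length C * V n (d ∸ 1)
  -- Distance 0 would force p n = 0, but p and n are positive.
  conclusion n zero N≤n 0≡pn =
    contradiction (subst (0 <_) (sym 0≡pn) (*-mono-≤ 0<p (≤-trans 0<N N≤n))) (λ ())
  conclusion n (suc r) N≤n eq = go (n ∸ r) (sym (m∸n+n≡m r≤n))
    where
    r≤n : r ≤ n
    r≤n = ≤-trans (n≤1+n r) (*-cancelʳ-≤ (suc r) n q (≤-trans (≤-reflexive eq)
            (≤-trans (*-monoˡ-≤ n (≤-trans (m≤n*m p 2) (<⇒≤ 2p<q))) (≤-reflexive (*-comm q n)))))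
    go : ∀ m → n ≡ m + r → Σ (List (Permutation′ n)) λ C →
         IsPermCode n (suc r) C × 1 * n * (n !) ≤ 3072 * q * length C * V n r
    go m refl = code m r N≤n eq
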